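{- For every composition $\alpha$ of $n$, $$\mathcal{HQ}_\alpha(X;Y)=\sum_{T\in SHCT(\alpha)}\tilde Q_{n,D(T)}(X;Y).$$
   Context: Fix $k,l\ge0$, $\mathcal{A}=\{1,\dots,k\}$, $\mathcal{A}'=\{1',\dots,l'\}$ with total order $1<\dots<k<1'<\dots<l'$, $X=(x_1,\dots,x_k)$, $Y=(y_1,\dots,y_l)$. French notation: row $i$ is the $i$-th from the bottom; cell $(i,j)$ is row $i$, column $j$. For a composition $\alpha=(\alpha_1,\dots,\alpha_r)$ with largest part $m$ the diagram has $\alpha_i$ cells in row $i$; for a filling $F$, $\hat F$ denotes the $r\times m$ array with $\infty$ (larger than all entries, in neither alphabet) in the missing cells. A hook composition tableau (HCT) of shape $\alpha$ is a filling $F$ with letters of $\mathcal{A}\cup\mathcal{A}'$ such that: rows weakly increase left to right; unprimed entries weakly and primed entries strictly increase along rows; in the leftmost column unprimed entries strictly and primed entries weakly increase bottom to top; and for all $1\le i<j\le r$, $1\le n<m$: (a) if $\hat F(i,n+1)\in\mathcal{A}$ and $\hat F(i,n+1)\ge\hat F(j,n)$ then $\hat F(i,n+1)>\hat F(j,n+1)$; (b) if $\hat F(i,n+1)\in\mathcal{A}'$ and $\hat F(i,n+1)>\hat F(j,n)$ then $\hat F(i,n+1)\ge\hat F(j,n+1)$. $\mathcal{HQ}_\alpha(X;Y)=\sum_F\prod_ix_i^{v_i}\prod_iy_i^{u_i}$ over HCT $F$ of shape $\alpha$, where $v_i,u_i$ count entries $i$, $i'$. A standard hook composition tableau of shape $\alpha\vDash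 n$ is a filling of the diagram of $\alpha$ with $1,\dots,n$, each used once, such that rows increase left to right, the leftmost column increases bottom to top, and for all $1\le i<j\le r$, $1\le n'<m$: if $\hat F(i,n'+1)\ne\infty$ and $\hat F(i,n'+1)>\hat F(j,n')$ then $\hat F(i,n'+1)>\hat F(j,n'+1)$. $SHCT(\alpha)$ is the set of these. The descent set of such $T$ is $D(T)=\{i\in[n-1]: i+1 \text{ lies in a column weakly left of the column of } i\}$. With $z_a=x_a$ ($a\in\mathcal{A}$), $z_{a'}=y_a$ ($a'\in\mathcal{A}'$), for $D\subseteq[n-1]$ let $\tilde Q_{n,D}(X;Y)=\sum z_{a_1}\cdots z_{a_n}$ over $a_1\le\dots\le a_n$ in $\mathcal{A}\cup\mathcal{A}'$ with $a_i=a_{i+1}\in\mathcal{A}\Rightarrow i\notin D$ and $a_i=a_{i+1}\in\mathcal{A}'\Rightarrow i\in D$. -}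

module Defs where

open import Level using (Level)
open import Data.Bool using (Bool; true; false; _∧_; _∨_; not; if_then_else_)
open import Data.Nat using (ℕ; zero; suc; _+_; _∸_; _⊔_; _<ᵇ_; _≡ᵇ_; _≤ᵇ_)
open import Data.Fin using (Fin; toℕ)
open import Data.Sum using (_⊎_; inj₁; inj₂)
open import Data.Maybe using (Maybe; just; nothing)
open import Data.List using (List; []; _∷_; [_]; map; _++_; concat; concatMap;
  mapMaybe; head; upTo; allFin; filterᵇ; length; foldr)
open import Data.Bool.ListAction using (and)
open import Data.Nat.ListAction using (sum)
open import Algebra.Bundles using (CommutativeSemiring)

all : {a : Level} {A : Set a} → (A → Bool) → List A → Bool
all p xs = and (map p xs)

-- 1-based lookup: nth xs i is the i-th element (nothing if out of range,
-- in particular for i = 0).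
nth : {a : Level} {A : Set a} → List A → ℕ → Maybe A
nth []       _             = nothing
nth (x ∷ xs) zero          = nothing
nth (x ∷ xs) (suc zero)    = just x
nth (x ∷ xs) (suc (suc i)) = nth xs (suc i)

fromTo : ℕ → ℕ → List ℕ
fromTo a b = map (a +_) (upTo (suc b ∸ a))

pairsOK : {a : Level} {A : Set a} → (A → A → Bool) → List A → Bool
pairsOK R (a ∷ b ∷ t) = R a b ∧ pairsOK R (b ∷ t)
pairsOK R _           = true

pairsIdxOK : {a : Level} {A : Set a} → (ℕ → A → A → Bool) → ℕ → List A → Bool
pairsIdxOK R i (a ∷ b ∷ t) = R i a b ∧ pairsIdxOK R (suc i) (b ∷ t)
pairsIdxOK R i _           = true

words : {a : Level} {A : Set a} → List A → ℕ → List (List A)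
words as zero    = [ [] ]
words as (suc n) = concatMap (λ c → map (c ∷_) (words as n)) as

-- all fillings of the diagram of α (row i = i-th list = i-th row from the
-- bottom, French notation) with letters from as
fillings : {a : Level} {A : Set a} → List A → List ℕ → List (List (List A))
fillings as []      = [ [] ]
fillings as (p ∷ α) = concatMap (λ w → map (w ∷_) (fillings as α)) (words as p)

-- F̂(i,j): entry in row i, column j (1-based), nothing = ∞
hat : {a : Level} {A : Set a} → List (List A) → ℕ → ℕ → Maybe A
hat F i j with nth F i
... | nothing  = nothing
... | just row = nth row j

maxPart : List ℕ → ℕ
maxPart = foldr _⊔_ 0

leftColumn : {a : Level} {A : Set a} → List (List A) → List A
leftColumn = mapMaybe head

shapeOf : {a : Level} {A : Set a} → List (List A) → List ℕ
shapeOf = map length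

-- Alphabets A = {1..k} (inj₁) and A' = {1'..l'} (inj₂), total order
-- 1 < ... < k < 1' < ... < l'

Letter : ℕ → ℕ → Set
Letter k l = Fin k ⊎ Fin l

allLetters : (k l : ℕ) → List (Letter k l)
allLetters k l = map inj₁ (allFin k) ++ map inj₂ (allFin l)

code : {k l : ℕ} → Letter k l → ℕ
code {k} (inj₁ a) = toℕ a
code {k} (inj₂ b) = k + toℕ b

unprimed : {k l : ℕ} → Letter k l → Bool
unprimed (inj₁ _) = true
unprimed (inj₂ _) = false

_<L_ _≤L_ _=L_ : {k l : ℕ} → Letter k l → Letter k l → Bool
a <L b = code a <ᵇ code b
a =L b = code a ≡ᵇ code b
a ≤L b = code a ≤ᵇ code b

-- comparisons of a letter with an entry of F̂ (nothing = ∞ > all letters)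
_>E_ _≥E_ : {k l : ℕ} → Letter k l → Maybe (Letter k l) → Bool
a >E nothing  = false
a >E just b   = b <L a
a ≥E nothing  = false
a ≥E just b   = b ≤L a

rowRel : {k l : ℕ} → Letter k l → Letter k l → Bool
rowRel a b = (a <L b) ∨ ((a =L b) ∧ unprimed a)

colRel : {k l : ℕ} → Letter k l → Letter k l → Bool
colRel a b = (a <L b) ∨ ((a =L b) ∧ not (unprimed a))

hctTriple : {k l : ℕ} → List (List (Letter k l)) → ℕ → ℕ → ℕ → Bool
hctTriple F i j n with hat F i (suc n)
... | nothing = true
... | just a  = if unprimed a
                then (not (a ≥E hat F j n) ∨ (a >E hat F j (suc n)))
                else (not (a >E hat F j n) ∨ (a ≥E hat F j (suc n)))

isHCT : {k l : ℕ} → List (List (Letter k l)) → Bool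
isHCT F =
  all (pairsOK rowRel) F
  ∧ pairsOK colRel (leftColumn F)
  ∧ all (λ i → all (λ j → all (λ n → hctTriple F i j n)
                                 (fromTo 1 (maxPart (shapeOf F) ∸ 1)))
                       (fromTo (suc i) (length F)))
        (fromTo 1 (length F))

_>N_ : ℕ → Maybe ℕ → Bool
a >N nothing = false
a >N just b  = b <ᵇ a

count : ℕ → List ℕ → ℕ
count v xs = length (filterᵇ (v ≡ᵇ_) xs)

shctTriple : List (List ℕ) → ℕ → ℕ → ℕ → Bool
shctTriple F i j n with hat F i (suc n)
... | nothing = true
... | just a  = not (a >N hat F j n) ∨ (a >N hat F j (suc n))

isSHCT : ℕ → List (List ℕ) → Bool
isSHCT n F =
  all (λ v → count v (concat F) ≡ᵇ 1) (fromTo 1 n)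
  ∧ all (pairsOK _<ᵇ_) F
  ∧ pairsOK _<ᵇ_ (leftColumn F)
  ∧ all (λ i → all (λ j → all (λ n' → shctTriple F i j n')
                                 (fromTo 1 (maxPart (shapeOf F) ∸ 1)))
                       (fromTo (suc i) (length F)))
        (fromTo 1 (length F))

-- SHCT(α), as a list (each tableau occurs exactly once)
SHCT : List ℕ → List (List (List ℕ))
SHCT α = filterᵇ (isSHCT (sum α)) (fillings (map suc (upTo (sum α))) α)

-- column (1-based) of the entry v in T (0 if absent)
posIn : List ℕ → ℕ → ℕ
posIn []       v = 0
posIn (x ∷ xs) v = if x ≡ᵇ v then 1 else (if posIn xs v ≡ᵇ 0 then 0 else suc (posIn xs v))

colOf : List (List ℕ) → ℕ → ℕ
colOf []          v = 0
colOf (row ∷ rows) v = if posIn row v ≡ᵇ 0 then colOf rows v else posIn row v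

descent : ℕ → List (List ℕ) → ℕ → Bool
descent n T i = (1 ≤ᵇ i) ∧ (i <ᵇ n) ∧ (colOf T (suc i) ≤ᵇ colOf T i)

-- Polynomials, evaluated in an arbitrary commutative semiring R at
-- X = x, Y = y.

module _ {c ℓ : Level} (R : CommutativeSemiring c ℓ) where
  open CommutativeSemiring R using (Carrier; 0#; 1#) renaming (_+_ to _+R_; _*_ to _*R_)

  sumR : List Carrier → Carrier
  sumR = foldr _+R_ 0#

  prodR : List Carrier → Carrier
  prodR = foldr _*R_ 1#

  z : {k l : ℕ} → (Fin k → Carrier) → (Fin l → Carrier) → Letter k l → Carrier
  z x y (inj₁ a) = x a
  z x y (inj₂ b) = y b

  HQ : (k l : ℕ) → (Fin k → Carrier) → (Fin l → Carrier) → List ℕ → Carrier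
  HQ k l x y α =
    sumR (map (λ F → prodR (map (z x y) (concat F)))
              (filterᵇ isHCT (fillings (allLetters k l) α)))

  Qtilde : (k l : ℕ) → (Fin k → Carrier) → (Fin l → Carrier) → ℕ → (ℕ → Bool) → Carrier
  Qtilde k l x y n D =
    sumR (map (λ w → prodR (map (z x y) w))
              (filterᵇ (pairsIdxOK cond 1) (words (allLetters k l) n)))
    where
    cond : ℕ → Letter k l → Letter k l → Bool
    cond i a b = (a ≤L b) ∧ (not (a =L b) ∨ (if unprimed a then not (D i) else D i))

{-# OPTIONS --safe #-}
-- The proof is by standardization. Order the cells of a hook composition tableau F by their
-- letters, equal unprimed letters by increasing column, and equal primed letters by decreasing
-- column, cells of one column being taken upwards in the leftmost column and downwards in the
-- others. Replacing each entry by its rank gives T ∈ SHCT(α), and the sorted entries of F form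
-- a word w with w compatible with D(T), from which F is recovered as w ∘ T.
--
-- Everything is expressed by two relations on letters: Row (< or equal unprimed) and Col
-- (< or equal primed). Both are transitive, and Row followed by Col, or Col followed by Row,
-- is strict. The tableau conditions (a) and (b) merge into one condition on Row and Col, and w
-- is compatible with D(T) when consecutive letters satisfy Row at the ascents of T (the column
-- increases) and Col at the descents. By transitivity the letters of any two entries u < v of T
-- satisfy Row or Col according to the columns of u and v, which yields the tableau conditions
-- for w ∘ T.
module Submission where

open import Defs
open import Level using (Level; 0ℓ)
open import Algebra.Bundles using (CommutativeSemiring; CommutativeMonoid)
open import Data.Bool using (Bool; true; false; T; _∧_; _∨_; not; if_then_else_)
open import Data.Bool.Properties using (T-≡; T-∧; T-∨)
open import Data.Fin using (Fin; toℕ)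
import Data.Fin.Properties as Fin
open import Data.Integer as ℤ using (ℤ; +<+)
import Data.Integer.Properties as ℤ
open import Data.List using (List; []; _∷_; map; _++_; concat; concatMap; length;
  upTo; applyUpTo; allFin; filter; filterᵇ; foldr; mapMaybe; cartesianProductWith)
open import Data.List.Properties using (length-map; length-upTo; map-∘; map-cong; map-cong-local;
  map-upTo; concat-map; filter-accept; filter-reject; filter-none;
  length-++; map-++; ∷-injective)
open import Data.List.Membership.Propositional using (_∈_; _∉_)
open import Data.List.Membership.Propositional.Properties using (∈-map⁺; ∈-map⁻; ∈-upTo⁺; ∈-upTo⁻;
  ∈-++⁺ˡ; ∈-++⁺ʳ; ∈-filter⁺; ∈-filter⁻; ∈-concat⁺′; ∈-concat⁻′; ∈-allFin;
  ∈-cartesianProductWith⁺; ∈-cartesianProductWith⁻)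
open import Data.List.Membership.Propositional.Properties.WithK using (unique∧set⇒bag)
open import Data.List.Relation.Binary.BagAndSetEquality using (∼bag⇒↭)
open import Data.List.Relation.Binary.Disjoint.Propositional using (Disjoint)
open import Data.List.Relation.Binary.Permutation.Propositional 
  using (_↭_; ↭-sym; ↭⇒↭ₛ; ↭⇒↭ₛ′)
import Data.List.Relation.Binary.Permutation.Propositional.Properties as Perm
import Data.List.Relation.Binary.Permutation.Setoid.Properties as PermS
import Data.List.Sort
import Data.List.Relation.Unary.Linked.Properties as Linked
open import Data.List.Relation.Unary.All as All using (All; []; _∷_)
import Data.List.Relation.Unary.All.Properties as All
open import Data.List.Relation.Unary.AllPairs as AllPairs using (AllPairs; []; _∷_)
import Data.List.Relation.Unary.AllPairs.Properties as AllPairs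
open import Data.List.Relation.Unary.Any using (here; there)
open import Data.List.Relation.Unary.Unique.Propositional using (Unique)
import Data.List.Relation.Unary.Unique.Propositional.Properties as Unique
open import Data.Maybe as Maybe using (Maybe; just; nothing; fromMaybe)
open import Data.Maybe.Properties using (just-injective)
open import Data.Nat using (ℕ; zero; suc; _+_; _∸_; _≤_; _<_; z≤n; s≤s; _<ᵇ_; _≤ᵇ_; _≡ᵇ_)
open import Data.Nat.Properties
open import Data.Nat.ListAction using (sum)
open import Data.Product using (∃; _×_; _,_; proj₁; proj₂)
open import Data.Product.Relation.Binary.Lex.Strict using (×-strictTotalOrder)
open import Data.Sum using (_⊎_; inj₁; inj₂)
open import Function using (_∘_; _⇔_; mk⇔; Equivalence)
open import Relation.Binary using (StrictTotalOrder; Transitive; tri<; tri≈; tri>)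
import Relation.Binary.Construct.On as On
import Relation.Binary.Reasoning.Setoid
import Relation.Binary.Properties.StrictTotalOrder as STO
open import Relation.Binary.PropositionalEquality using (_≡_; _≢_; refl; sym; trans; cong; cong₂;
  subst; subst₂; setoid; module ≡-Reasoning)
open import Relation.Unary using (Decidable)
open import Relation.Nullary using (¬_; yes; no)
open import Relation.Nullary.Negation using (contradiction)

private variable
  a b c p q : Level
  A : Set a
  B : Set b

-- Lists with 1-based lookup.

nth-zero : (xs : List A) → nth xs 0 ≡ nothing
nth-zero []       = refl
nth-zero (_ ∷ _) = refl

nth-map : (f : A → B) (xs : List A) (p : ℕ) → nth (map f xs) p ≡ Maybe.map f (nth xs p)
nth-map f []       p             = refl
nth-map f (x ∷ xs) zero          = refl
nth-map f (x ∷ xs) (suc zero)    = refl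
nth-map f (x ∷ xs) (suc (suc p)) = nth-map f xs (suc p)

nth-bounds : (xs : List A) {p : ℕ} {x : A} → nth xs p ≡ just x → 1 ≤ p × p ≤ length xs
nth-bounds (x ∷ xs) {suc zero}    eq = s≤s z≤n , s≤s z≤n
nth-bounds (x ∷ xs) {suc (suc p)} eq = s≤s z≤n , s≤s (proj₂ (nth-bounds xs eq))

nth-pred : (xs : List A) {p : ℕ} {x : A} → 1 ≤ p → nth xs (suc p) ≡ just x →
  ∃ λ y → nth xs p ≡ just y
nth-pred (x ∷ xs) {suc zero}    _ eq = x , refl
nth-pred (x ∷ xs) {suc (suc p)} _ eq = nth-pred xs (s≤s z≤n) eq

nth-∈ : (xs : List A) {p : ℕ} {x : A} → nth xs p ≡ just x → x ∈ xs
nth-∈ (x ∷ xs) {suc zero}    refl = here refl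
nth-∈ (x ∷ xs) {suc (suc p)} eq   = there (nth-∈ xs eq)

∈-nth : {xs : List A} {x : A} → x ∈ xs → ∃ λ p → nth xs (suc p) ≡ just x
∈-nth (here refl) = 0 , refl
∈-nth (there x∈) with ∈-nth x∈
... | p , eq = suc p , eq

nth-AllPairs : {R : A → A → Set b} {xs : List A} → AllPairs R xs → ∀ {p q x y} →
  nth xs p ≡ just x → nth xs q ≡ just y → p < q → R x y
nth-AllPairs (_ ∷ _) {zero} () _ _
nth-AllPairs (_ ∷ _) {suc _} {suc zero} _ _ (s≤s ())
nth-AllPairs {xs = _ ∷ xs} (rx ∷ _) {suc zero} {suc (suc q)} refl eq _ =
  All.lookup rx (nth-∈ xs eq)
nth-AllPairs (_ ∷ rs) {suc (suc p)} {suc (suc q)} eq eq′ (s≤s p<q) = nth-AllPairs rs eq eq′ p<q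

nth-ext : (xs ys : List A) → length xs ≡ length ys →
  (∀ {p x} → nth xs p ≡ just x → nth ys p ≡ just x) → xs ≡ ys
nth-ext []       []       _  _ = refl
nth-ext (x ∷ xs) (y ∷ ys) eq h = cong₂ _∷_ (sym (just-injective (h {1} refl)))
  (nth-ext xs ys (suc-injective eq)
    λ { {zero} e → contradiction (trans (sym (nth-zero xs)) e) λ ()
      ; {suc p} → h {suc (suc p)} })

-- The check numbers its first pair `m`, so the pair at positions `suc p` and `suc (suc p)` carries
-- the index `p + m`.
pairsIdxOK⁻ : {r : ℕ → A → A → Bool} (m : ℕ) (xs : List A) → T (pairsIdxOK r m xs) →
  ∀ {p x y} → nth xs (suc p) ≡ just x → nth xs (suc (suc p)) ≡ just y → T (r (p + m) x y)
pairsIdxOK⁻ {r = r} m (x ∷ y ∷ xs) ok {zero} refl refl =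
  proj₁ (Equivalence.to (T-∧ {r m x y}) ok)
pairsIdxOK⁻ {r = r} m (x ∷ y ∷ xs) ok {suc p} {u} {v} eq eq′ =
  subst (λ q → T (r q u v)) (+-suc p m)
    (pairsIdxOK⁻ (suc m) (y ∷ xs) (proj₂ (Equivalence.to (T-∧ {r m x y}) ok)) eq eq′)
pairsIdxOK⁻ m [] ok ()
pairsIdxOK⁻ m (x ∷ []) ok {zero} refl ()
pairsIdxOK⁻ m (x ∷ []) ok {suc p} ()

pairsIdxOK⁺ : {r : ℕ → A → A → Bool} (m : ℕ) (xs : List A) →
  (∀ {p x y} → nth xs (suc p) ≡ just x → nth xs (suc (suc p)) ≡ just y → T (r (p + m) x y)) →
  T (pairsIdxOK r m xs)
pairsIdxOK⁺ m [] h = _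
pairsIdxOK⁺ m (x ∷ []) h = _
pairsIdxOK⁺ {r = r} m (x ∷ y ∷ xs) h = Equivalence.from (T-∧ {r m x y})
  (h {0} refl refl , pairsIdxOK⁺ (suc m) (y ∷ xs) λ {p} {u} {v} eq eq′ →
    subst (λ q → T (r q u v)) (sym (+-suc p m)) (h {suc p} eq eq′))

pairsOK≡pairsIdxOK : (r : A → A → Bool) (m : ℕ) (xs : List A) →
  pairsOK r xs ≡ pairsIdxOK (λ _ → r) m xs
pairsOK≡pairsIdxOK r m []           = refl
pairsOK≡pairsIdxOK r m (x ∷ [])     = refl
pairsOK≡pairsIdxOK r m (x ∷ y ∷ xs) = cong (r x y ∧_) (pairsOK≡pairsIdxOK r (suc m) (y ∷ xs))

pairsOK⇔ : {r : A → A → Bool} (xs : List A) →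
  T (pairsOK r xs) ⇔ (∀ {p x y} → nth xs p ≡ just x → nth xs (suc p) ≡ just y → T (r x y))
pairsOK⇔ {r = r} xs rewrite pairsOK≡pairsIdxOK r 0 xs = mk⇔
  (λ { ok {zero} e → contradiction (trans (sym (nth-zero xs)) e) λ ()
     ; ok {suc p} → pairsIdxOK⁻ 0 xs ok {p} })
  (λ h → pairsIdxOK⁺ 0 xs λ {p} → h {suc p})

all-fromTo⁻ : {p : ℕ → Bool} (m n : ℕ) → T (all p (fromTo m n)) →
  ∀ {i} → m ≤ i → i ≤ n → T (p i)
all-fromTo⁻ {p} m n ok m≤i i≤n = subst (T ∘ p) (m+[n∸m]≡n m≤i)
  (All.lookup (All.all⁺ p (fromTo m n) ok)
    (∈-map⁺ (m +_) (∈-upTo⁺ (∸-monoˡ-< (s≤s i≤n) m≤i))))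

all-fromTo⁺ : {p : ℕ → Bool} (m n : ℕ) → (∀ i → m ≤ i → T (p i)) → T (all p (fromTo m n))
all-fromTo⁺ {p} m n h = All.all⁻ p (All.map⁺
  (All.universal (λ i → h (m + i) (m≤m+n m i)) (upTo (suc n ∸ m))))

-- Entries of fillings.

hat⁺ : (F : List (List A)) {i j : ℕ} {r : List A} → nth F i ≡ just r → hat F i j ≡ nth r j
hat⁺ F {i} eq with nth F i
hat⁺ F refl | just r = refl

hat⁻ : (F : List (List A)) {i j : ℕ} {x : A} → hat F i j ≡ just x →
  ∃ λ r → nth F i ≡ just r × nth r j ≡ just x
hat⁻ F {i} eq with nth F i
... | just r = r , refl , eq

hat-map : (f : A → B) (F : List (List A)) (i j : ℕ) →
  hat (map (map f) F) i j ≡ Maybe.map f (hat F i j)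
hat-map f F i j with nth (map (map f) F) i | nth-map (map f) F i
... | _ | refl with nth F i
...   | nothing = refl
...   | just r  = nth-map f r j

map-just⁻ : {f : A → B} (m : Maybe A) {y : B} → Maybe.map f m ≡ just y →
  ∃ λ x → m ≡ just x × f x ≡ y
map-just⁻ (just x) refl = x , refl , refl

hat-map⁻ : (f : A → B) (F : List (List A)) {i j : ℕ} {y : B} →
  hat (map (map f) F) i j ≡ just y → ∃ λ x → hat F i j ≡ just x × f x ≡ y
hat-map⁻ f F {i} {j} eq = map-just⁻ (hat F i j) (trans (sym (hat-map f F i j)) eq)

hat-map⁺ : (f : A → B) (F : List (List A)) {i j : ℕ} {x : A} →
  hat F i j ≡ just x → hat (map (map f) F) i j ≡ just (f x)
hat-map⁺ f F {i} {j} eq = trans (hat-map f F i j) (cong (Maybe.map f) eq)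

-- A present entry forces its indices into the ranges over which the Boolean checks quantify, so the
-- tableau conditions can be stated for all indices.
hat-bounds : (F : List (List A)) {i j : ℕ} {x : A} → hat F i j ≡ just x →
  (1 ≤ i × i ≤ length F) × (1 ≤ j × j ≤ maxPart (shapeOf F))
hat-bounds F {i} eq with hat⁻ F eq
... | r , eqᵣ , eqₓ = nth-bounds F eqᵣ , proj₁ (nth-bounds r eqₓ) ,
  ≤-trans (proj₂ (nth-bounds r eqₓ)) (length≤maxPart F i eqᵣ)
  where
  length≤maxPart : ∀ F i → nth F i ≡ just r → length r ≤ maxPart (shapeOf F)
  length≤maxPart (r ∷ F) (suc zero)    refl = m≤m⊔n (length r) _
  length≤maxPart (r ∷ F) (suc (suc i)) eq   =
    ≤-trans (length≤maxPart F (suc i) eq) (m≤n⊔m (length r) _)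

hat-pred : (F : List (List A)) {i j : ℕ} {x : A} → 1 ≤ j → hat F i (suc j) ≡ just x →
  ∃ λ y → hat F i j ≡ just y
hat-pred F 1≤j eq with hat⁻ F eq
... | r , eqᵣ , eqₓ with nth-pred r 1≤j eqₓ
...   | y , eq′ = y , trans (hat⁺ F eqᵣ) eq′

hat-∈ : (F : List (List A)) {i j : ℕ} {x : A} → hat F i j ≡ just x → x ∈ concat F
hat-∈ F eq with hat⁻ F eq
... | r , eqᵣ , eqₓ = ∈-concat⁺′ (nth-∈ r eqₓ) (nth-∈ F eqᵣ)

∈-hat : (F : List (List A)) {x : A} → x ∈ concat F → ∃ λ i → ∃ λ j → hat F i j ≡ just x
∈-hat F x∈ with ∈-concat⁻′ F x∈
... | r , x∈r , r∈F with ∈-nth x∈r | ∈-nth r∈F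
...   | j , eqⱼ | i , eqᵢ = suc i , suc j , trans (hat⁺ F eqᵢ) eqⱼ

-- Nonempty rows and the tableau conditions.

RowsNonempty : List (List A) → Set _
RowsNonempty = All (λ r → 0 < length r)

-- `mapMaybe head` skips empty rows; without any, positions in the left column are row indices.
leftColumn-nth : (F : List (List A)) → RowsNonempty F → ∀ i → nth (leftColumn F) i ≡ hat F i 1
leftColumn-nth []            _        i             = refl
leftColumn-nth ((x ∷ r) ∷ F) (_ ∷ _)  zero          = refl
leftColumn-nth ((x ∷ r) ∷ F) (_ ∷ _)  (suc zero)    = refl
leftColumn-nth ((x ∷ r) ∷ F) (_ ∷ ne) (suc (suc i)) = leftColumn-nth F ne (suc i)

-- The conditions on hook composition tableaux and on standard ones have this common form:
-- (a) and (b) say that for i < j, F(j,n) before F(i,n+1) in the sense of a row forces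
-- F(j,n+1) before F(i,n+1) in the sense of a column.
TripleAt : {A : Set a} (r c : A → A → Bool) (F : List (List A)) → ℕ → ℕ → ℕ → Set a
TripleAt r c F i j n = ∀ {x y} → hat F i (suc n) ≡ just x → hat F j n ≡ just y →
  T (r y x) → ∃ λ w → hat F j (suc n) ≡ just w × T (c w x)

-- Used with `rowRel` and `colRel` for hook composition tableaux, and with `_<ᵇ_` twice for standard
-- ones. All hypotheses speak of present entries, so an infinite F̂(j,n) leaves the triple condition
-- vacuous, while an infinite F̂(j,n+1) violates it once the premise holds.
record Tableau {A : Set a} (r c : A → A → Bool) (F : List (List A)) : Set a where
  field
    row : ∀ {i j x y} → hat F i j ≡ just x → hat F i (suc j) ≡ just y → T (r x y)
    col : ∀ {i x y} → hat F i 1 ≡ just x → hat F (suc i) 1 ≡ just y → T (c x y)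
    triple : ∀ {i j n} → i < j → TripleAt r c F i j n

module _ (r c : A → A → Bool) (t : ℕ → ℕ → ℕ → Bool) (F : List (List A)) where

  -- By definition this is `isHCT F` for `rowRel`, `colRel` and `hctTriple F`, and what `isSHCT`
  -- checks after the counts for `_<ᵇ_`, `_<ᵇ_` and `shctTriple F`.
  isTableau : Bool
  isTableau = all (pairsOK r) F
    ∧ pairsOK c (leftColumn F)
    ∧ all (λ i → all (λ j → all (λ n → t i j n)
                                   (fromTo 1 (maxPart (shapeOf F) ∸ 1)))
                         (fromTo (suc i) (length F)))
          (fromTo 1 (length F))

  isTableau⁻ : RowsNonempty F → (∀ i j n → T (t i j n) → TripleAt r c F i j n) →
    T isTableau → Tableau r c F
  isTableau⁻ ne t⁻ ok with Equivalence.to (T-∧ {all (pairsOK r) F}) ok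
  ... | okʳ , ok′ with Equivalence.to (T-∧ {pairsOK c (leftColumn F)}) ok′
  ...   | okᶜ , okᵗ = record
    { row = λ {i} {j} ex ey → rowOK {i} {j} ex ey
    ; col = λ {i} ex ey → Equivalence.to (pairsOK⇔ (leftColumn F)) okᶜ {i}
        (trans (leftColumn-nth F ne _) ex) (trans (leftColumn-nth F ne _) ey)
    ; triple = λ {i} {j} {n} i<j ex ey →
        -- The range of `n` stops one short of the largest part: the upper bound comes from the
        -- entry in column `suc n`, the lower bound from the one in column `n`.
        let (1≤i , i≤) , (_ , n<) = hat-bounds F ex
            (_ , j≤) , (1≤n , _) = hat-bounds F ey
        in t⁻ i j n (all-fromTo⁻ 1 _ (all-fromTo⁻ (suc i) _ (all-fromTo⁻ 1 _ okᵗ 1≤i i≤) i<j j≤)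
             1≤n (∸-monoˡ-≤ 1 n<)) ex ey
    }
    where
    rowOK : ∀ {i j x y} → hat F i j ≡ just x → hat F i (suc j) ≡ just y → T (r x y)
    rowOK {i} {j} ex ey with hat⁻ F {i} {j} ex
    ... | w , ew , ex′ = Equivalence.to (pairsOK⇔ w)
      (All.lookup (All.all⁺ (pairsOK r) F okʳ) (nth-∈ F ew)) ex′ (trans (sym (hat⁺ F ew)) ey)

  isTableau⁺ : RowsNonempty F → (∀ i j n → TripleAt r c F i j n → T (t i j n)) →
    Tableau r c F → T isTableau
  isTableau⁺ ne t⁺ tab = Equivalence.from T-∧ (All.all⁻ (pairsOK r) (All.tabulate rowOK) ,
    Equivalence.from T-∧ (colOK , all-fromTo⁺ 1 (length F) λ i _ →
    all-fromTo⁺ (suc i) (length F) λ j i<j → all-fromTo⁺ 1 (maxPart (shapeOf F) ∸ 1) λ n _ →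
      t⁺ i j n (Tableau.triple tab i<j)))
    where
    rowOK : ∀ {w} → w ∈ F → T (pairsOK r w)
    rowOK {w} w∈ with ∈-nth w∈
    ... | i , ew = Equivalence.from (pairsOK⇔ w) λ {p} ex ey →
      Tableau.row tab {suc i} {p} (trans (hat⁺ F ew) ex) (trans (hat⁺ F ew) ey)
    colOK : T (pairsOK c (leftColumn F))
    colOK = Equivalence.from (pairsOK⇔ (leftColumn F)) λ {p} ex ey → Tableau.col tab {p}
      (trans (sym (leftColumn-nth F ne p)) ex) (trans (sym (leftColumn-nth F ne (suc p))) ey)

Tableau-col< : {r c : A → A → Bool} {F : List (List A)} → RowsNonempty F → Tableau r c F →
  Transitive (λ x y → T (c x y)) → ∀ {i j x y} → i < j →
  hat F i 1 ≡ just x → hat F j 1 ≡ just y → T (c x y)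
Tableau-col< {F = F} ne tab tr {i} {suc j} i<j ex ey with m<1+n⇒m<n∨m≡n i<j
... | inj₂ refl = Tableau.col tab {i} ex ey
... | inj₁ i<j′ with nth-pred (leftColumn F) (<-≤-trans (s≤s z≤n) i<j′)
                      (trans (leftColumn-nth F ne (suc j)) ey)
...   | w , ew = tr (Tableau-col< ne tab tr i<j′ ex ew′) (Tableau.col tab {j} ew′ ey)
  where ew′ = trans (sym (leftColumn-nth F ne j)) ew

-- Letters, the relations `Row` and `Col`, and compatibility.

T-⇒ : {x y : Bool} → T (not x ∨ y) ⇔ (T x → T y)
T-⇒ {true}  = mk⇔ (λ t _ → t) (λ h → h _)
T-⇒ {false} = mk⇔ (λ _ ()) (λ _ → _)

private variable
  k l : ℕ

-- Unprimed codes are below `k` and primed codes are at least `k`, so the two alphabets cannot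
-- collide.
code-injective : (u v : Letter k l) → code u ≡ code v → u ≡ v
code-injective (inj₁ u) (inj₁ v) eq = cong inj₁ (Fin.toℕ-injective eq)
code-injective {k} (inj₁ u) (inj₂ v) eq =
  contradiction (subst (_< k) eq (Fin.toℕ<n u)) (m+n≮m k (toℕ v))
code-injective {k} (inj₂ u) (inj₁ v) eq =
  contradiction (subst (_< k) (sym eq) (Fin.toℕ<n v)) (m+n≮m k (toℕ u))
code-injective {k} (inj₂ u) (inj₂ v) eq = cong inj₂ (Fin.toℕ-injective (+-cancelˡ-≡ k _ _ eq))

data Row {k l} : Letter k l → Letter k l → Set where
  less  : ∀ {u v} → code u < code v → Row u v
  equal : ∀ {u} → Row (inj₁ u) (inj₁ u)

data Col {k l} : Letter k l → Letter k l → Set where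
  less  : ∀ {u v} → code u < code v → Col u v
  equal : ∀ {u} → Col (inj₂ u) (inj₂ u)

Row-refl : (u : Letter k l) → T (unprimed u) → Row u u
Row-refl (inj₁ _) _ = equal

Col-refl : (u : Letter k l) → T (not (unprimed u)) → Col u u
Col-refl (inj₂ _) _ = equal

=L-refl : (u : Letter k l) → T (u =L u)
=L-refl u = ≡⇒≡ᵇ (code u) (code u) refl

rowRel⇔Row : (u v : Letter k l) → T (rowRel u v) ⇔ Row u v
rowRel⇔Row {k} {l} u v = mk⇔ to from
  where
  to : T (rowRel u v) → Row u v
  to t with Equivalence.to (T-∨ {u <L v}) t
  ... | inj₁ u<v = less (<ᵇ⇒< _ _ u<v)
  ... | inj₂ t′ with Equivalence.to (T-∧ {u =L v}) t′
  ...   | e , un = subst (Row u) (code-injective u v (≡ᵇ⇒≡ _ _ e)) (Row-refl u un)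
  from : ∀ {u v : Letter k l} → Row u v → T (rowRel u v)
  from {u} {v} (less u<v) = Equivalence.from (T-∨ {u <L v}) (inj₁ (<⇒<ᵇ u<v))
  from {u} equal = Equivalence.from (T-∨ {u <L u})
    (inj₂ (Equivalence.from (T-∧ {u =L u}) (=L-refl u , _)))

colRel⇔Col : (u v : Letter k l) → T (colRel u v) ⇔ Col u v
colRel⇔Col {k} {l} u v = mk⇔ to from
  where
  to : T (colRel u v) → Col u v
  to t with Equivalence.to (T-∨ {u <L v}) t
  ... | inj₁ u<v = less (<ᵇ⇒< _ _ u<v)
  ... | inj₂ t′ with Equivalence.to (T-∧ {u =L v}) t′
  ...   | e , pr = subst (Col u) (code-injective u v (≡ᵇ⇒≡ _ _ e)) (Col-refl u pr)
  from : ∀ {u v : Letter k l} → Col u v → T (colRel u v)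
  from {u} {v} (less u<v) = Equivalence.from (T-∨ {u <L v}) (inj₁ (<⇒<ᵇ u<v))
  from {u} equal = Equivalence.from (T-∨ {u <L u})
    (inj₂ (Equivalence.from (T-∧ {u =L u}) (=L-refl u , _)))

Row-trans : Transitive (Row {k} {l})
Row-trans (less p) (less q) = less (<-trans p q)
Row-trans (less p) equal    = less p
Row-trans equal    q        = q

Col-trans : Transitive (Col {k} {l})
Col-trans (less p) (less q) = less (<-trans p q)
Col-trans (less p) equal    = less p
Col-trans equal    q        = q

-- Equality on both sides would make the middle letter both unprimed and primed, so at least one of
-- the two steps is strict.
Row-Col⇒< : {u v w : Letter k l} → Row u v → Col v w → code u < code w
Row-Col⇒< (less p) (less q) = <-trans p q
Row-Col⇒< (less p) equal    = p
Row-Col⇒< equal    (less q) = q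

Col-Row⇒< : {u v w : Letter k l} → Col u v → Row v w → code u < code w
Col-Row⇒< (less p) (less q) = <-trans p q
Col-Row⇒< (less p) equal    = p
Col-Row⇒< equal    (less q) = q

Row-Col-asym : {u v : Letter k l} → Row u v → ¬ Col v u
Row-Col-asym r c = <-irrefl refl (Row-Col⇒< r c)

-- The condition defining Qtilde at a position i, with d = true when i ∈ D.
compatible : Bool → Letter k l → Letter k l → Bool
compatible d u v = (u ≤L v) ∧ (not (u =L v) ∨ (if unprimed u then not d else d))

≤L⇒ : (u v : Letter k l) → T (u ≤L v) → code u < code v ⊎ u ≡ v
≤L⇒ u v t with m≤n⇒m<n∨m≡n (≤ᵇ⇒≤ _ _ t)
... | inj₁ p = inj₁ p
... | inj₂ e = inj₂ (code-injective u v e)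

compatible-less : (d : Bool) (u v : Letter k l) → code u < code v → T (compatible d u v)
compatible-less d u v p = Equivalence.from (T-∧ {u ≤L v}) (≤⇒≤ᵇ (<⇒≤ p) ,
  Equivalence.from (T-⇒ {u =L v}) λ e → contradiction p (<-irrefl (≡ᵇ⇒≡ _ _ e)))

compatible-equal : (d : Bool) (u : Letter k l) →
  T (compatible d u u) ⇔ T (if unprimed u then not d else d)
compatible-equal d u = mk⇔
  (λ t → Equivalence.to (T-⇒ {u =L u}) (proj₂ (Equivalence.to (T-∧ {u ≤L u}) t)) (=L-refl u))
  (λ t → Equivalence.from (T-∧ {u ≤L u}) (≤⇒≤ᵇ (≤-refl {code u}) ,
    Equivalence.from (T-⇒ {u =L u}) λ _ → t))

-- At a descent equal letters must be primed, which is exactly where `Col` admits equality;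
-- `compatible-false` is the dual fact for ascents and `Row`.
compatible-true : (u v : Letter k l) → T (compatible true u v) ⇔ Col u v
compatible-true {k} {l} u v = mk⇔ to from
  where
  if-eta : (u : Letter k l) → (if unprimed u then false else true) ≡ not (unprimed u)
  if-eta (inj₁ _) = refl
  if-eta (inj₂ _) = refl
  to : T (compatible true u v) → Col u v
  to t with ≤L⇒ u v (proj₁ (Equivalence.to (T-∧ {u ≤L v}) t))
  ... | inj₁ p = less p
  ... | inj₂ refl = Col-refl u (subst T (if-eta u) (Equivalence.to (compatible-equal true u) t))
  from : ∀ {u v : Letter k l} → Col u v → T (compatible true u v)
  from {u} {v} (less p) = compatible-less true u v p
  from {u} equal = Equivalence.from (compatible-equal true u) _

compatible-false : (u v : Letter k l) → T (compatible false u v) ⇔ Row u v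
compatible-false {k} {l} u v = mk⇔ to from
  where
  if-eta : (u : Letter k l) → (if unprimed u then true else false) ≡ unprimed u
  if-eta (inj₁ _) = refl
  if-eta (inj₂ _) = refl
  to : T (compatible false u v) → Row u v
  to t with ≤L⇒ u v (proj₁ (Equivalence.to (T-∧ {u ≤L v}) t))
  ... | inj₁ p = less p
  ... | inj₂ refl = Row-refl u (subst T (if-eta u) (Equivalence.to (compatible-equal false u) t))
  from : ∀ {u v : Letter k l} → Row u v → T (compatible false u v)
  from {u} {v} (less p) = compatible-less false u v p
  from {u} equal = Equivalence.from (compatible-equal false u) _

-- The Boolean triple conditions as `TripleAt`.

hctCheck : Letter k l → Maybe (Letter k l) → Maybe (Letter k l) → Bool
hctCheck x m m′ = if unprimed x then (not (x ≥E m) ∨ (x >E m′)) else (not (x >E m) ∨ (x ≥E m′))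

-- For unprimed `x`, `Row y x` means y ≤ x and `Col w x` means w < x, which is (a); for primed `x`
-- they mean y < x and w ≤ x, which is (b). An infinite `m` makes the premise false, an infinite
-- `m′` the conclusion.
hctCheck⇔ : (x : Letter k l) (m m′ : Maybe (Letter k l)) → T (hctCheck x m m′) ⇔
  (∀ y → m ≡ just y → T (rowRel y x) → ∃ λ w → m′ ≡ just w × T (colRel w x))
hctCheck⇔ {k} {l} (inj₁ x) m m′ = mk⇔
  (λ { t y refl r → exists m′ (Equivalence.to (T-⇒ {u ≥E m}) t
       (≤⁺ y (Equivalence.to (rowRel⇔Row y u) r))) })
  (λ h → Equivalence.from (T-⇒ {u ≥E m}) (from m h))
  where
  u : Letter k l
  u = inj₁ x
  ≤⁺ : ∀ y → Row y u → T (y ≤L u)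
  ≤⁺ y (less p) = ≤⇒≤ᵇ (<⇒≤ p)
  ≤⁺ y equal    = ≤⇒≤ᵇ (≤-refl {toℕ x})
  ≤⁻ : ∀ y → T (y ≤L u) → Row y u
  ≤⁻ y t with ≤L⇒ y u t
  ... | inj₁ p    = less p
  ... | inj₂ refl = equal
  exists : ∀ m′ → T (u >E m′) → ∃ λ w → m′ ≡ just w × T (colRel w u)
  exists (just w) t = w , refl , Equivalence.from (colRel⇔Col w u) (less (<ᵇ⇒< _ _ t))
  from : ∀ m → (∀ y → m ≡ just y → T (rowRel y u) →
    ∃ λ w → m′ ≡ just w × T (colRel w u)) →
    T (u ≥E m) → T (u >E m′)
  from (just y) h t with h y refl (Equivalence.from (rowRel⇔Row y u) (≤⁻ y t))
  ... | w , refl , c with Equivalence.to (colRel⇔Col w u) c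
  ...   | less p = <⇒<ᵇ p
hctCheck⇔ {k} {l} (inj₂ x) m m′ = mk⇔
  (λ { t y refl r → exists m′ (Equivalence.to (T-⇒ {u >E m}) t
       (<⁺ y (Equivalence.to (rowRel⇔Row y u) r))) })
  (λ h → Equivalence.from (T-⇒ {u >E m}) (from m h))
  where
  u : Letter k l
  u = inj₂ x
  <⁺ : ∀ y → Row y u → T (y <L u)
  <⁺ y (less p) = <⇒<ᵇ p
  ≤⁺ : ∀ y → Col y u → T (y ≤L u)
  ≤⁺ y (less p) = ≤⇒≤ᵇ (<⇒≤ p)
  ≤⁺ y equal    = ≤⇒≤ᵇ (≤-refl {k + toℕ x})
  ≤⁻ : ∀ y → T (y ≤L u) → Col y u
  ≤⁻ y t with ≤L⇒ y u t
  ... | inj₁ p    = less p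
  ... | inj₂ refl = equal
  exists : ∀ m′ → T (u ≥E m′) → ∃ λ w → m′ ≡ just w × T (colRel w u)
  exists (just w) t = w , refl , Equivalence.from (colRel⇔Col w u) (≤⁻ w t)
  from : ∀ m → (∀ y → m ≡ just y → T (rowRel y u) →
    ∃ λ w → m′ ≡ just w × T (colRel w u)) →
    T (u >E m) → T (u ≥E m′)
  from (just y) h t with h y refl (Equivalence.from (rowRel⇔Row y u) (less (<ᵇ⇒< _ _ t)))
  ... | w , refl , c = ≤⁺ w (Equivalence.to (colRel⇔Col w u) c)

hctTriple⇔ : (F : List (List (Letter k l))) (i j n : ℕ) →
  T (hctTriple F i j n) ⇔ TripleAt rowRel colRel F i j n
hctTriple⇔ F i j n with hat F i (suc n)
... | nothing = mk⇔ (λ _ ()) (λ _ → _)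
... | just x  = mk⇔
  (λ { t {y = y} refl → Equivalence.to (hctCheck⇔ x (hat F j n) (hat F j (suc n))) t y })
  (λ h → Equivalence.from (hctCheck⇔ x (hat F j n) (hat F j (suc n))) λ y → h {x} {y} refl)

>N⇔ : (u : ℕ) (m : Maybe ℕ) → T (u >N m) ⇔ (∃ λ v → m ≡ just v × T (v <ᵇ u))
>N⇔ u nothing = mk⇔ (λ ()) (λ { (_ , () , _) })
>N⇔ u (just v)  = mk⇔ (λ t → v , refl , t) (λ { (_ , refl , p) → p })

shctTriple⇔ : (F : List (List ℕ)) (i j n : ℕ) →
  T (shctTriple F i j n) ⇔ TripleAt _<ᵇ_ _<ᵇ_ F i j n
shctTriple⇔ F i j n with hat F i (suc n)
... | nothing = mk⇔ (λ _ ()) (λ _ → _)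
... | just x  = mk⇔
  (λ { t refl ey p → Equivalence.to (>N⇔ x _) (Equivalence.to (T-⇒ {x >N hat F j n}) t
       (Equivalence.from (>N⇔ x (hat F j n)) (_ , ey , p))) })
  (λ h → Equivalence.from (T-⇒ {x >N hat F j n}) λ t →
       let y , ey , p = Equivalence.to (>N⇔ x (hat F j n)) t
       in Equivalence.from (>N⇔ x (hat F j (suc n))) (h {x} {y} refl ey p))

isHCT⇒Tableau : {F : List (List (Letter k l))} → RowsNonempty F → T (isHCT F) →
  Tableau rowRel colRel F
isHCT⇒Tableau {F = F} ne = isTableau⁻ rowRel colRel (hctTriple F) F ne
  λ i j n → Equivalence.to (hctTriple⇔ F i j n)

Tableau⇒isHCT : {F : List (List (Letter k l))} → RowsNonempty F → Tableau rowRel colRel F →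
  T (isHCT F)
Tableau⇒isHCT {F = F} ne = isTableau⁺ rowRel colRel (hctTriple F) F ne
  λ i j n → Equivalence.from (hctTriple⇔ F i j n)

-- Ranks with respect to a strict total order

module Rank {a ℓ₁ ℓ₂} (O : StrictTotalOrder a ℓ₁ ℓ₂) where
  open StrictTotalOrder O using (Carrier; irrefl; asym; module Eq)
    renaming (_<_ to _≺_; _<?_ to _≺?_)

  -- The successor makes ranks start at 1, in step with `nth`.
  rank : List Carrier → Carrier → ℕ
  rank xs x = suc (length (filter (_≺? x) xs))

  rank-↭ : ∀ {xs ys} x → xs ↭ ys → rank xs x ≡ rank ys x
  rank-↭ x p = cong suc (Perm.↭-length (Perm.filter-↭ (_≺? x) p))

  rank-head : ∀ {x xs} → All (x ≺_) xs → rank (x ∷ xs) x ≡ 1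
  rank-head {x} {xs} x≺ = cong (suc ∘ length) (trans
    (filter-reject (_≺? x) (irrefl Eq.refl))
    (filter-none (_≺? x) (All.map (λ x≺y y≺x → asym x≺y y≺x) x≺)))

  rank-tail : ∀ {x y xs} → x ≺ y → rank (x ∷ xs) y ≡ suc (rank xs y)
  rank-tail {y = y} x≺y = cong (suc ∘ length) (filter-accept (_≺? y) x≺y)

  rank-nth : ∀ {xs} → AllPairs _≺_ xs → ∀ {p x} → nth xs p ≡ just x → rank xs x ≡ p
  rank-nth (x≺ ∷ _) {suc zero} refl = rank-head x≺
  rank-nth {_ ∷ xs} (x≺ ∷ xs≺) {suc (suc p)} eq =
    trans (rank-tail (All.lookup x≺ (nth-∈ xs eq))) (cong suc (rank-nth xs≺ eq))

  nth-rank : ∀ {xs x} → AllPairs _≺_ xs → x ∈ xs → nth xs (rank xs x) ≡ just x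
  nth-rank {xs} {x} xs≺ x∈ with ∈-nth x∈
  ... | p , eq = subst (λ q → nth xs q ≡ just x) (sym (rank-nth xs≺ eq)) eq

  rank-cancel-< : ∀ {xs x y} → AllPairs _≺_ xs → x ∈ xs → y ∈ xs →
    rank xs x < rank xs y → x ≺ y
  rank-cancel-< xs≺ x∈ y∈ = nth-AllPairs xs≺ (nth-rank xs≺ x∈) (nth-rank xs≺ y∈)

  -- Of the three ways to compare the ranks, a reversed one would reverse `≺`, and equal ranks would
  -- look up the same element.
  rank-mono-< : ∀ {xs x y} → AllPairs _≺_ xs → x ∈ xs → y ∈ xs →
    x ≺ y → rank xs x < rank xs y
  rank-mono-< {xs} {x} {y} xs≺ x∈ y∈ x≺y with <-cmp (rank xs x) (rank xs y)
  ... | tri< lt _ _ = lt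
  ... | tri> _ _ gt = contradiction (rank-cancel-< xs≺ y∈ x∈ gt) (asym x≺y)
  ... | tri≈ _ eq _ = contradiction x≺y (irrefl (Eq.reflexive (just-injective
    (trans (sym (nth-rank xs≺ x∈)) (trans (cong (nth xs) eq) (nth-rank xs≺ y∈))))))

-- With `P` and `Q` saying that an element precedes a given one, this transports ranks between two
-- orders on labels of the same objects.
length-filter-map : {C : Set c} {P : A → Set p} {Q : B → Set q}
  (P? : Decidable P) (Q? : Decidable Q) {g : C → A} {h : C → B} (xs : List C) →
  (∀ {x} → x ∈ xs → P (g x) ⇔ Q (h x)) →
  length (filter P? (map g xs)) ≡ length (filter Q? (map h xs))
length-filter-map P? Q? []       eqv = refl
length-filter-map P? Q? {g} {h} (x ∷ xs) eqv with P? (g x) | Q? (h x)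
... | yes _ | yes _ = cong suc (length-filter-map P? Q? xs (eqv ∘ there))
... | no _  | no _  = length-filter-map P? Q? xs (eqv ∘ there)
... | yes p | no ¬q = contradiction (Equivalence.to (eqv (here refl)) p) ¬q
... | no ¬p | yes q = contradiction (Equivalence.from (eqv (here refl)) q) ¬p

-- The list of the integers from 1 to n.

interval : ℕ → List ℕ
interval n = map suc (upTo n)

length-interval : ∀ n → length (interval n) ≡ n
length-interval n = trans (length-map suc (upTo n)) (length-upTo n)

interval-increasing : ∀ n → AllPairs _<_ (interval n)
interval-increasing n = subst (AllPairs _<_) (sym (map-upTo suc n))
  (AllPairs.applyUpTo⁺₁ suc n λ i<j _ → s≤s i<j)

∈-interval⁻ : ∀ {n i} → i ∈ interval n → 1 ≤ i × i ≤ n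
∈-interval⁻ i∈ with ∈-map⁻ suc i∈
... | _ , i<n , refl = s≤s z≤n , ∈-upTo⁻ i<n

interval-unique : ∀ n → Unique (interval n)
interval-unique n = AllPairs.map <⇒≢ (interval-increasing n)

nth-applyUpTo : (f : ℕ → A) {n i : ℕ} → i < n → nth (applyUpTo f n) (suc i) ≡ just (f i)
nth-applyUpTo f {suc n} {zero}  _         = refl
nth-applyUpTo f {suc n} {suc i} (s≤s i<n) = nth-applyUpTo (f ∘ suc) i<n

nth-interval : ∀ {n i} → 1 ≤ i → i ≤ n → nth (interval n) i ≡ just i
nth-interval {n} {suc i} _ i≤n =
  trans (cong (λ xs → nth xs (suc i)) (map-upTo suc n)) (nth-applyUpTo suc i≤n)

-- Fillings annotated with positions

Cell : Set a → Set a
Cell A = ℕ × ℕ × A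

value : Cell A → A
value (_ , _ , x) = x

mapValue : (A → B) → Cell A → Cell B
mapValue f (i , j , x) = i , j , f x

-- `j` counts the columns already passed, so that starting from 0 the columns are numbered from 1.
annotateRow : ℕ → ℕ → List A → List (Cell A)
annotateRow i j []       = []
annotateRow i j (x ∷ xs) = (i , suc j , x) ∷ annotateRow i (suc j) xs

annotateFrom : ℕ → List (List A) → List (List (Cell A))
annotateFrom i []      = []
annotateFrom i (r ∷ F) = annotateRow (suc i) 0 r ∷ annotateFrom (suc i) F

annotate : List (List A) → List (List (Cell A))
annotate = annotateFrom 0

cells : List (List A) → List (Cell A)
cells F = concat (annotate F)

nth-annotateRow : ∀ i j (xs : List A) p →
  nth (annotateRow i j xs) p ≡ Maybe.map (λ x → i , j + p , x) (nth xs p)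
nth-annotateRow i j []       p             = refl
nth-annotateRow i j (x ∷ xs) zero          = refl
nth-annotateRow i j (x ∷ xs) (suc zero)    = cong (λ q → just (i , q , x)) (sym (+-comm j 1))
nth-annotateRow i j (x ∷ xs) (suc (suc p)) = trans (nth-annotateRow i (suc j) xs (suc p))
  (cong (λ q → Maybe.map (λ y → i , q , y) (nth xs (suc p))) (sym (+-suc j (suc p))))

nth-annotateFrom : ∀ i (F : List (List A)) p →
  nth (annotateFrom i F) p ≡ Maybe.map (annotateRow (i + p) 0) (nth F p)
nth-annotateFrom i []      p             = refl
nth-annotateFrom i (r ∷ F) zero          = refl
nth-annotateFrom i (r ∷ F) (suc zero)    = cong (λ q → just (annotateRow q 0 r)) (sym (+-comm i 1))
nth-annotateFrom i (r ∷ F) (suc (suc p)) = trans (nth-annotateFrom (suc i) F (suc p))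
  (cong (λ q → Maybe.map (annotateRow q 0) (nth F (suc p))) (sym (+-suc i (suc p))))

hat-annotate : ∀ (F : List (List A)) i j →
  hat (annotate F) i j ≡ Maybe.map (λ x → i , j , x) (hat F i j)
hat-annotate F i j with nth (annotate F) i | nth-annotateFrom 0 F i
... | _ | refl with nth F i
...   | nothing = refl
...   | just r  = nth-annotateRow i 0 r j

hat⇒∈-cells : ∀ (F : List (List A)) {i j x} → hat F i j ≡ just x → (i , j , x) ∈ cells F
hat⇒∈-cells F {i} {j} eq = hat-∈ (annotate F)
  (trans (hat-annotate F i j) (cong (Maybe.map _) eq))

∈-cells⇒hat : ∀ (F : List (List A)) {i j x} → (i , j , x) ∈ cells F → hat F i j ≡ just x
∈-cells⇒hat F c∈ with ∈-hat (annotate F) c∈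
... | i , j , eq with map-just⁻ (hat F i j) (trans (sym (hat-annotate F i j)) eq)
...   | _ , eq′ , refl = eq′

annotateRow-map : (f : A → B) (i j : ℕ) (xs : List A) →
  annotateRow i j (map f xs) ≡ map (mapValue f) (annotateRow i j xs)
annotateRow-map f i j []       = refl
annotateRow-map f i j (x ∷ xs) = cong (_ ∷_) (annotateRow-map f i (suc j) xs)

annotateFrom-map : (f : A → B) (i : ℕ) (F : List (List A)) →
  annotateFrom i (map (map f) F) ≡ map (map (mapValue f)) (annotateFrom i F)
annotateFrom-map f i []      = refl
annotateFrom-map f i (r ∷ F) = cong₂ _∷_ (annotateRow-map f (suc i) 0 r) (annotateFrom-map f (suc i) F)

cells-map : (f : A → B) (F : List (List A)) → cells (map (map f) F) ≡ map (mapValue f) (cells F)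
cells-map f F = trans (cong concat (annotateFrom-map f 0 F)) (concat-map (annotate F))

value-annotateRow : (i j : ℕ) (xs : List A) → map value (annotateRow i j xs) ≡ xs
value-annotateRow i j []       = refl
value-annotateRow i j (x ∷ xs) = cong (x ∷_) (value-annotateRow i (suc j) xs)

value-annotateFrom : (i : ℕ) (F : List (List A)) → map (map value) (annotateFrom i F) ≡ F
value-annotateFrom i []      = refl
value-annotateFrom i (r ∷ F) = cong₂ _∷_ (value-annotateRow (suc i) 0 r) (value-annotateFrom (suc i) F)

value-cells : (F : List (List A)) → map value (cells F) ≡ concat F
value-cells F = trans (sym (concat-map (annotate F))) (cong concat (value-annotateFrom 0 F))

annotateRow-cols : (i j : ℕ) (xs : List A) →
  All (λ (i′ , j′ , _) → i ≡ i′ × j < j′) (annotateRow i j xs)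
annotateRow-cols i j []       = []
annotateRow-cols i j (x ∷ xs) =
  (refl , ≤-refl) ∷ All.map (λ (e , p) → e , <⇒≤ p) (annotateRow-cols i (suc j) xs)

annotateFrom-rows : (i : ℕ) (F : List (List A)) →
  All (λ (i′ , _ , _) → i < i′) (concat (annotateFrom i F))
annotateFrom-rows i []      = []
annotateFrom-rows i (r ∷ F) = All.++⁺
  (All.map (λ { (refl , _) → ≤-refl }) (annotateRow-cols (suc i) 0 r))
  (All.map <⇒≤ (annotateFrom-rows (suc i) F))

annotateRow-unique : (i j : ℕ) (xs : List A) → Unique (annotateRow i j xs)
annotateRow-unique i j []       = []
annotateRow-unique i j (x ∷ xs) =
  All.map (λ { (_ , p) refl → <-irrefl refl p }) (annotateRow-cols i (suc j) xs)
  ∷ annotateRow-unique i (suc j) xs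

annotateFrom-unique : (i : ℕ) (F : List (List A)) → Unique (concat (annotateFrom i F))
annotateFrom-unique i []      = []
annotateFrom-unique i (r ∷ F) = Unique.++⁺ (annotateRow-unique (suc i) 0 r)
  (annotateFrom-unique (suc i) F) λ (x∈ , x∈′) → <-irrefl
    (proj₁ (All.lookup (annotateRow-cols (suc i) 0 r) x∈))
    (All.lookup (annotateFrom-rows (suc i) F) x∈′)

-- Letters may repeat, but positions do not: columns separate the cells of one row, and row indices
-- separate the rows.
cells-unique : (F : List (List A)) → Unique (cells F)
cells-unique = annotateFrom-unique 0

-- The total order on cells that standardization follows

-- Integer keys let negation reverse the reading direction for primed letters.
colKey : Letter k l → ℕ → ℤ
colKey (inj₁ _) j = ℤ.+ j
colKey (inj₂ _) j = ℤ.- (ℤ.+ j)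

-- Equal primed letters are read upwards in the leftmost column, where standard entries increase
-- upwards. In a later column the left neighbour of the upper one is strictly smaller, so the triple
-- condition makes the upper one the smaller standard entry: these are read downwards.
rowKey : Letter k l → ℕ → ℕ → ℤ
rowKey (inj₁ _) _ i = ℤ.+ i
rowKey (inj₂ _) 1 i = ℤ.+ i
rowKey (inj₂ _) _ i = ℤ.- (ℤ.+ i)

cellKey : Cell (Letter k l) → ℕ × ℤ × ℤ
cellKey (i , j , u) = code u , colKey u j , rowKey u j i

cellOrder : (k l : ℕ) → StrictTotalOrder 0ℓ 0ℓ 0ℓ
cellOrder k l = On.strictTotalOrder
  (×-strictTotalOrder <-strictTotalOrder
    (×-strictTotalOrder ℤ.<-strictTotalOrder ℤ.<-strictTotalOrder))
  (cellKey {k} {l})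

module CellOrder {k l : ℕ} where
  open StrictTotalOrder (cellOrder k l) public using () renaming (_<_ to _≺_; _≈_ to _≈ᶜ_)
  open Rank (cellOrder k l) public
  open Data.List.Sort (STO.decTotalOrder (cellOrder k l)) using (sort; sort-↭; sort-↗)

  -- The key determines the cell: first the letter, then the column, and then the row, since letter
  -- and column fix the sign in `rowKey`.
  ≈ᶜ⇒≡ : {c d : Cell (Letter k l)} → c ≈ᶜ d → c ≡ d
  ≈ᶜ⇒≡ {i , j , u} {i′ , j′ , v} (e , e₁ , e₂) with code-injective u v e
  ≈ᶜ⇒≡ {i , j , inj₁ x} (_ , refl , refl) | refl = refl
  ≈ᶜ⇒≡ {i , j , inj₂ x} {i′ , j′ , _} (_ , e₁ , e₂) | refl
    with ℤ.+-injective (ℤ.neg-injective {ℤ.+ j} {ℤ.+ j′} e₁)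
  ≈ᶜ⇒≡ {i , zero , inj₂ x} (_ , _ , e₂) | refl | refl =
    cong (_, _) (ℤ.+-injective (ℤ.neg-injective e₂))
  ≈ᶜ⇒≡ {i , suc zero , inj₂ x} (_ , _ , e₂) | refl | refl = cong (_, _) (ℤ.+-injective e₂)
  ≈ᶜ⇒≡ {i , suc (suc j) , inj₂ x} (_ , _ , e₂) | refl | refl =
    cong (_, _) (ℤ.+-injective (ℤ.neg-injective e₂))

  Row⇒≺ : ∀ {i i′ j j′} {u v : Letter k l} → j < j′ → Row u v → (i , j , u) ≺ (i′ , j′ , v)
  Row⇒≺ j<j′ (less p) = inj₁ p
  Row⇒≺ j<j′ equal    = inj₂ (refl , inj₁ (+<+ j<j′))

  Col⇒≺ : ∀ {i i′ j j′} {u v : Letter k l} → j′ < j → Col u v → (i , j , u) ≺ (i′ , j′ , v)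
  Col⇒≺ j′<j (less p) = inj₁ p
  Col⇒≺ j′<j equal    = inj₂ (refl , inj₁ (ℤ.neg-mono-< (+<+ j′<j)))

  Col⇒≺-leftmost : ∀ {i i′} {u v : Letter k l} → i < i′ → Col u v → (i , 1 , u) ≺ (i′ , 1 , v)
  Col⇒≺-leftmost i<i′ (less p) = inj₁ p
  Col⇒≺-leftmost i<i′ equal    = inj₂ (refl , inj₂ (refl , +<+ i<i′))

  Col⇒≺-inner : ∀ {i i′ j} {u v : Letter k l} → 1 ≤ j → i′ < i → Col u v →
    (i , suc j , u) ≺ (i′ , suc j , v)
  Col⇒≺-inner _       i′<i (less p) = inj₁ p
  Col⇒≺-inner (s≤s _) i′<i equal    = inj₂ (refl , inj₂ (refl , ℤ.neg-mono-< (+<+ i′<i)))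

  ≺⇒Row : ∀ {i i′ j j′} {u v : Letter k l} → j < j′ → (i , j , u) ≺ (i′ , j′ , v) → Row u v
  ≺⇒Row j<j′ (inj₁ p) = less p
  ≺⇒Row {u = u} {v} j<j′ (inj₂ (e , q)) with code-injective u v e
  ≺⇒Row {u = inj₁ x} j<j′ (inj₂ (e , q)) | refl = equal
  ≺⇒Row {u = inj₂ x} j<j′ (inj₂ (e , inj₁ q)) | refl =
    contradiction (ℤ.drop‿+<+ (ℤ.neg-cancel-< q)) (<-asym j<j′)
  ≺⇒Row {u = inj₂ x} j<j′ (inj₂ (e , inj₂ (q , _))) | refl =
    contradiction (ℤ.+-injective (ℤ.neg-injective q)) (<⇒≢ j<j′)

  -- Equal unprimed letters are read left to right, so moving weakly left leaves only a common
  -- column. This exception is excluded later by the tableau conditions.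
  ≺⇒Col : ∀ {i i′ j j′} {u v : Letter k l} → j′ ≤ j → (i , j , u) ≺ (i′ , j′ , v) →
    Col u v ⊎ (T (unprimed u) × u ≡ v × j ≡ j′ × i < i′)
  ≺⇒Col j′≤j (inj₁ p) = inj₁ (less p)
  ≺⇒Col {u = u} {v} j′≤j (inj₂ (e , q)) with code-injective u v e
  ≺⇒Col {u = inj₂ x} j′≤j (inj₂ (e , q)) | refl = inj₁ equal
  ≺⇒Col {u = inj₁ x} j′≤j (inj₂ (e , inj₁ q)) | refl =
    contradiction (ℤ.drop‿+<+ q) (≤⇒≯ j′≤j)
  ≺⇒Col {u = inj₁ x} j′≤j (inj₂ (e , inj₂ (q , r))) | refl =
    inj₂ (_ , refl , ℤ.+-injective q , ℤ.drop‿+<+ r)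

  order : List (List (Letter k l)) → List (Cell (Letter k l))
  order F = sort (cells F)

  order-↭ : ∀ F → order F ↭ cells F
  order-↭ F = sort-↭ (cells F)

  -- Sorting gives a weak order; the cells are distinct and equivalent cells are equal, so it is
  -- strict.
  order-increasing : ∀ F → AllPairs _≺_ (order F)
  order-increasing F = AllPairs.zipWith
    (λ { (inj₁ p , _) → p ; (inj₂ e , c≢d) → contradiction (≈ᶜ⇒≡ e) c≢d })
    ( Linked.Linked⇒AllPairs (λ {c} {d} {e} → STO.trans (cellOrder k l) {c} {d} {e}) (sort-↗ (cells F))
    , PermS.Unique-resp-↭ (setoid _) (↭⇒↭ₛ (↭-sym (order-↭ F))) (cells-unique F))

  standardization : List (List (Letter k l)) → List (List ℕ)
  standardization F = map (map (rank (order F))) (annotate F)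

  sortedWord : List (List (Letter k l)) → List (Letter k l)
  sortedWord F = map value (order F)

-- Descents and the columns of entries.

descent≡ : ∀ {n} t {i} → 1 ≤ i → i < n → descent n t i ≡ (colOf t (suc i) ≤ᵇ colOf t i)
descent≡ t {i} 1≤i i<n
  rewrite Equivalence.to T-≡ (≤⇒≤ᵇ 1≤i) | Equivalence.to T-≡ (<⇒<ᵇ i<n) = refl

-- With `p` and `q` the columns of two consecutive entries, `q ≤ᵇ p` is the descent bit. The pair of
-- implications, one of them vacuous, is the form that composes along a chain of entries.
compatible-≤ᵇ : ∀ {p q} (u v : Letter k l) →
  T (compatible (q ≤ᵇ p) u v) ⇔ ((p < q → Row u v) × (q ≤ p → Col u v))
compatible-≤ᵇ {p = p} {q} u v with q ≤ᵇ p in eq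
... | true  = mk⇔
  (λ t → (λ p<q → contradiction (≤ᵇ⇒≤ q p (Equivalence.from T-≡ eq)) (<⇒≱ p<q)) ,
         λ _ → Equivalence.to (compatible-true u v) t)
  (λ (_ , c) → Equivalence.from (compatible-true u v) (c (≤ᵇ⇒≤ q p (Equivalence.from T-≡ eq))))
... | false = mk⇔
  (λ t → (λ _ → Equivalence.to (compatible-false u v) t) , λ q≤p → contradiction q≤p q≰p)
  (λ (r , _) → Equivalence.from (compatible-false u v) (r (≰⇒> q≰p)))
  where
  q≰p : ¬ q ≤ p
  q≰p q≤p = subst T eq (≤⇒≤ᵇ q≤p)

≡ᵇ-refl : ∀ v → (v ≡ᵇ v) ≡ true
≡ᵇ-refl v = Equivalence.to T-≡ (≡⇒≡ᵇ v v refl)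

≢⇒≡ᵇ-false : ∀ {u v} → u ≢ v → (u ≡ᵇ v) ≡ false
≢⇒≡ᵇ-false {u} {v} u≢v with u ≡ᵇ v in eq
... | false = refl
... | true  = contradiction (≡ᵇ⇒≡ u v (Equivalence.from T-≡ eq)) u≢v

posIn-nth : ∀ xs {p v} → Unique xs → nth xs p ≡ just v → posIn xs v ≡ p
posIn-nth (x ∷ xs) {suc zero}    _         refl rewrite ≡ᵇ-refl x = refl
posIn-nth (x ∷ xs) {suc (suc p)} (x∉ ∷ un) eq
  rewrite ≢⇒≡ᵇ-false (All.lookup x∉ (nth-∈ xs eq)) | posIn-nth xs un eq = refl

posIn-∉ : ∀ xs {v} → v ∉ xs → posIn xs v ≡ 0
posIn-∉ []       v∉ = refl
posIn-∉ (x ∷ xs) v∉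
  rewrite ≢⇒≡ᵇ-false (v∉ ∘ here ∘ sym) | posIn-∉ xs (v∉ ∘ there) = refl

Unique-++⁻ : (xs : List A) {ys : List A} → Unique (xs ++ ys) →
  Unique xs × Unique ys × Disjoint xs ys
Unique-++⁻ []       un       = [] , un , λ ()
Unique-++⁻ (x ∷ xs) (x∉ ∷ un) with Unique-++⁻ xs un
... | unˡ , unʳ , dis = All.++⁻ˡ xs x∉ ∷ unˡ , unʳ , λ
  { (here refl , y∈) → All.lookup (All.++⁻ʳ xs x∉) y∈ refl
  ; (there x∈ , y∈) → dis (x∈ , y∈) }

colOf-hat : ∀ t → Unique (concat t) → ∀ {i j v} → hat t i j ≡ just v → colOf t v ≡ j
colOf-hat (r ∷ t) un {suc zero} {j} eq with Unique-++⁻ r un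
-- `posIn` uses 0 for absence; columns start at 1, so `j` is a successor and `colOf` stops in this
-- row.
... | unʳ , _ , _ rewrite posIn-nth r unʳ eq with j | nth-bounds r eq
...   | suc _ | _ = refl
colOf-hat (r ∷ t) un {suc (suc i)} {j} {v} eq with Unique-++⁻ r un
... | _ , unᵗ , dis rewrite posIn-∉ r {v} (λ v∈r → dis (v∈r , hat-∈ t {suc i} eq)) =
  colOf-hat t unᵗ {suc i} eq

-- Distinctness and maps over fillings.

Unique-resp-↭ : {xs ys : List A} → xs ↭ ys → Unique xs → Unique ys
Unique-resp-↭ p = PermS.Unique-resp-↭ (setoid _) (↭⇒↭ₛ p)

Unique-map-injective : (f : A → B) {xs : List A} → Unique (map f xs) →
  ∀ {x y} → x ∈ xs → y ∈ xs → f x ≡ f y → x ≡ y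
Unique-map-injective f un         (here refl) (here refl) eq = refl
Unique-map-injective f (fx∉ ∷ _)  (here refl) (there y∈)  eq =
  contradiction eq (All.lookup fx∉ (∈-map⁺ f y∈))
Unique-map-injective f (fx∉ ∷ _)  (there x∈)  (here refl) eq =
  contradiction (sym eq) (All.lookup fx∉ (∈-map⁺ f x∈))
Unique-map-injective f (_ ∷ un)   (there x∈)  (there y∈)  eq = Unique-map-injective f un x∈ y∈ eq

map-map-cong : {f g : A → B} (F : List (List A)) → (∀ {x} → x ∈ concat F → f x ≡ g x) →
  map (map f) F ≡ map (map g) F
map-map-cong F eq = map-cong-local (All.tabulate λ r∈ →
  map-cong-local (All.tabulate λ x∈ → eq (∈-concat⁺′ x∈ r∈)))

map-map-∘ : {C : Set c} (g : B → C) (f : A → B) (F : List (List A)) →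
  map (map g) (map (map f) F) ≡ map (map (g ∘ f)) F
map-map-∘ g f F = trans (sym (map-∘ F)) (map-cong (λ r → sym (map-∘ r)) F)

-- Standardization of a hook composition tableau

module Standardize {k l : ℕ} {F : List (List (Letter k l))} (ne : RowsNonempty F)
  (tab : Tableau rowRel colRel F) where

  open CellOrder {k} {l}
  open Tableau tab

  private
    size : ℕ
    size = length (order F)

    rk : Cell (Letter k l) → ℕ
    rk = rank (order F)

    ∈-order : ∀ {i j u} → hat F i j ≡ just u → (i , j , u) ∈ order F
    ∈-order eq = Perm.∈-resp-↭ (↭-sym (order-↭ F)) (hat⇒∈-cells F eq)

    order-∈ : ∀ {i j u} → (i , j , u) ∈ order F → hat F i j ≡ just u
    order-∈ c∈ = ∈-cells⇒hat F (Perm.∈-resp-↭ (order-↭ F) c∈)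

    hat-std⁺ : ∀ {i j u} → hat F i j ≡ just u → hat (standardization F) i j ≡ just (rk (i , j , u))
    hat-std⁺ {i} {j} eq = hat-map⁺ rk (annotate F)
      (trans (hat-annotate F i j) (cong (Maybe.map _) eq))

    hat-std⁻ : ∀ {i j v} → hat (standardization F) i j ≡ just v →
      ∃ λ u → hat F i j ≡ just u × rk (i , j , u) ≡ v
    hat-std⁻ {i} {j} eq with hat-map⁻ rk (annotate F) eq
    ... | _ , eqᶜ , eqᵥ with map-just⁻ (hat F i j) (trans (sym (hat-annotate F i j)) eqᶜ)
    ...   | u , eqᵤ , refl = u , eqᵤ , eqᵥ

    rk-mono : ∀ {i j i′ j′ u v} → hat F i j ≡ just u → hat F i′ j′ ≡ just v →
      (i , j , u) ≺ (i′ , j′ , v) → T (rk (i , j , u) <ᵇ rk (i′ , j′ , v))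
    rk-mono eu ev c≺d = <⇒<ᵇ (rank-mono-< (order-increasing F) (∈-order eu) (∈-order ev) c≺d)

    rk-cancel : ∀ {i j i′ j′ u v} → hat F i j ≡ just u → hat F i′ j′ ≡ just v →
      T (rk (i , j , u) <ᵇ rk (i′ , j′ , v)) → (i , j , u) ≺ (i′ , j′ , v)
    rk-cancel eu ev lt = rank-cancel-< (order-increasing F) (∈-order eu) (∈-order ev) (<ᵇ⇒< _ _ lt)

    Col-irrefl : (u : Letter k l) → T (unprimed u) → ¬ T (colRel u u)
    Col-irrefl u un t with u | Equivalence.to (colRel⇔Col u u) t
    ... | inj₁ _ | less p = <-irrefl refl p

    -- The leftmost column is strict on unprimed letters. In a later column the left neighbour of
    -- the upper copy is `Row`-related to the lower copy, so the triple condition would relate `u`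
    -- to itself by `Col`.
    unprimed-column-distinct : ∀ {i i′ j u} → i < i′ → T (unprimed u) →
      hat F i j ≡ just u → ¬ hat F i′ j ≡ just u
    unprimed-column-distinct {j = zero} i<i′ un e e′ with hat-bounds F e
    ... | _ , () , _
    unprimed-column-distinct {j = suc zero} {u} i<i′ un e e′ = Col-irrefl u un
      (Tableau-col< ne tab (λ {u} {v} {w} → colRel-trans {u} {v} {w}) i<i′ e e′)
      where
      colRel-trans : Transitive (λ (u v : Letter k l) → T (colRel u v))
      colRel-trans {u} {v} {w} p q = Equivalence.from (colRel⇔Col u w)
        (Col-trans (Equivalence.to (colRel⇔Col u v) p) (Equivalence.to (colRel⇔Col v w) q))
    unprimed-column-distinct {i} {i′} {suc (suc j)} {u} i<i′ un e e′ with hat-pred F (s≤s z≤n) e′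
    ... | y , ey with triple i<i′ e ey (row {i′} {suc j} ey e′)
    ...   | w , ew , c with just-injective (trans (sym ew) e′)
    ...     | refl = Col-irrefl u un c

  -- Ranks preserve and reflect `≺`, so each condition passes through the correspondence of `≺` with
  -- `Row` and `Col` for the columns involved.
  standardization-Tableau : Tableau _<ᵇ_ _<ᵇ_ (standardization F)
  standardization-Tableau = record { row = row′ ; col = col′ ; triple = triple′ }
    where
    row′ : ∀ {i j x y} → hat (standardization F) i j ≡ just x →
      hat (standardization F) i (suc j) ≡ just y → T (x <ᵇ y)
    row′ {i} {j} ex ey with hat-std⁻ {i} {j} ex | hat-std⁻ {i} {suc j} ey
    ... | u , eu , refl | v , ev , refl = rk-mono {i} {j} eu ev
      (Row⇒≺ ≤-refl (Equivalence.to (rowRel⇔Row u v) (row {i} {j} eu ev)))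
    col′ : ∀ {i x y} → hat (standardization F) i 1 ≡ just x →
      hat (standardization F) (suc i) 1 ≡ just y → T (x <ᵇ y)
    col′ {i} ex ey with hat-std⁻ {i} ex | hat-std⁻ {suc i} ey
    ... | u , eu , refl | v , ev , refl = rk-mono {i} eu ev
      (Col⇒≺-leftmost ≤-refl (Equivalence.to (colRel⇔Col u v) (col {i} eu ev)))
    triple′ : ∀ {i j n} → i < j → TripleAt _<ᵇ_ _<ᵇ_ (standardization F) i j n
    triple′ {i} {j} {n} i<j ex ey y<x with hat-std⁻ {i} ex | hat-std⁻ {j} ey
    ... | u , eu , refl | v , ev , refl with triple i<j eu ev
          (Equivalence.from (rowRel⇔Row v u) (≺⇒Row {j} {i} ≤-refl (rk-cancel {j} {n} ev eu y<x)))
    -- The entry in column `n` shows 1 ≤ n, so column `suc n` is read downwards and the upper cell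
    -- comes first.
    ...   | w , ew , c = _ , hat-std⁺ {j} ew , rk-mono {j} ew eu
            (Col⇒≺-inner (proj₁ (proj₂ (hat-bounds F {j} ev))) i<j (Equivalence.to (colRel⇔Col w u) c))

  -- Along the sorted list of cells the ranks are 1, 2, and so on; the cells of `F` are a
  -- permutation of that list.
  standardization-↭ : concat (standardization F) ↭ interval size
  standardization-↭ = subst₂ _↭_ (sym (concat-map (annotate F)))
    (nth-ext _ _ (trans (length-map rk (order F)) (sym (length-interval size))) nth-rk)
    (Perm.map⁺ rk (↭-sym (order-↭ F)))
    where
    nth-rk : ∀ {p x} → nth (map rk (order F)) p ≡ just x → nth (interval size) p ≡ just x
    nth-rk {p} eq with map-just⁻ (nth (order F) p) (trans (sym (nth-map rk (order F) p)) eq)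
    ... | c , ec , refl rewrite rank-nth (order-increasing F) {p} ec =
      let 1≤p , p≤ = nth-bounds (order F) ec in nth-interval 1≤p p≤

  -- The columns of consecutive standard entries are those of consecutive cells of `order F`, so
  -- `≺⇒Row` applies at ascents and `≺⇒Col` at descents, where `unprimed-column-distinct` removes
  -- the exception.
  sortedWord-compatible : T (pairsIdxOK (λ i → compatible (descent size (standardization F) i)) 1
    (sortedWord F))
  sortedWord-compatible = pairsIdxOK⁺ 1 (sortedWord F) λ {p} {x} {y} ex ey → compat {p} {x} {y} ex ey
    where
    t = standardization F
    un : Unique (concat t)
    un = Unique-resp-↭ (↭-sym standardization-↭) (interval-unique size)
    colOf-rk : ∀ {p i j u} → nth (order F) p ≡ just (i , j , u) → colOf t p ≡ j
    colOf-rk {p} {i} {j} {u} ec = colOf-hat t un {i} (trans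
      (hat-std⁺ {i} {j} (order-∈ (nth-∈ (order F) {p} ec)))
      (cong just (rank-nth (order-increasing F) ec)))
    compat : ∀ {p x y} → nth (sortedWord F) (suc p) ≡ just x →
      nth (sortedWord F) (suc (suc p)) ≡ just y → T (compatible (descent size t (p + 1)) x y)
    compat {p} {x} {y} ex ey
      with map-just⁻ (nth (order F) (suc p)) (trans (sym (nth-map value (order F) (suc p))) ex)
         | map-just⁻ (nth (order F) (suc (suc p))) (trans (sym (nth-map value (order F) (suc (suc p)))) ey)
    ... | (i , j , u) , ec , refl | (i′ , j′ , v) , ed , refl
      rewrite +-comm p 1 | descent≡ {size} t {suc p} (s≤s z≤n) (proj₂ (nth-bounds (order F) ed))
            | colOf-rk {suc p} ec | colOf-rk {suc (suc p)} ed =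
      Equivalence.from (compatible-≤ᵇ u v) ((λ j<j′ → ≺⇒Row {i} {i′} j<j′ c≺d) , leftward)
      where
      c≺d : (i , j , u) ≺ (i′ , j′ , v)
      c≺d = nth-AllPairs (order-increasing F) {suc p} {suc (suc p)} ec ed ≤-refl
      leftward : j′ ≤ j → Col u v
      leftward j′≤j with ≺⇒Col {i} {i′} j′≤j c≺d
      ... | inj₁ r = r
      ... | inj₂ (unp , refl , refl , i<i′) = contradiction
        (order-∈ (nth-∈ (order F) {suc (suc p)} ed))
        (unprimed-column-distinct i<i′ unp (order-∈ (nth-∈ (order F) {suc p} ec)))

  -- This recovers `F` from its standardization and its sorted word.
  nth-sortedWord : ∀ {c} → c ∈ cells F → nth (sortedWord F) (rk c) ≡ just (value c)
  nth-sortedWord {c} c∈ = trans (nth-map value (order F) (rk c)) (cong (Maybe.map value)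
    (nth-rank (order-increasing F) (Perm.∈-resp-↭ (↭-sym (order-↭ F)) c∈)))

-- From a standard tableau and a compatible word to a hook composition tableau

module Destandardize {k l n : ℕ} {t : List (List ℕ)} (ne : RowsNonempty t)
  (t↭ : concat t ↭ interval n) (tab : Tableau _<ᵇ_ _<ᵇ_ t) (f : ℕ → Letter k l)
  (compat : ∀ i → 1 ≤ i → i < n → T (compatible (descent n t i) (f i) (f (suc i)))) where

  open CellOrder {k} {l}

  filled : List (List (Letter k l))
  filled = map (map f) t

  private
    module ℕRank = Rank <-strictTotalOrder

    unique : Unique (concat t)
    unique = Unique-resp-↭ (↭-sym t↭) (interval-unique n)

    bounds : ∀ {i j v} → hat t i j ≡ just v → 1 ≤ v × v ≤ n
    bounds {i} e = ∈-interval⁻ (Perm.∈-resp-↭ t↭ (hat-∈ t {i} e))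

    Before : ℕ → ℕ → Set
    Before u v = (colOf t u < colOf t v → Row (f u) (f v)) × (colOf t v ≤ colOf t u → Col (f u) (f v))

    -- Two steps in the same direction compose by `Row-trans` or `Col-trans`. Steps in opposite
    -- directions give a strict inequality of letters, hence both `Row` and `Col`, wherever the end
    -- columns lie.
    Before-trans : Transitive Before
    Before-trans {u} {v} {w} (r₁ , c₁) (r₂ , c₂)
      with <-≤-connex (colOf t u) (colOf t v) | <-≤-connex (colOf t v) (colOf t w)
    ... | inj₁ u<v | inj₁ v<w = (λ _ → Row-trans (r₁ u<v) (r₂ v<w)) ,
                                λ w≤u → contradiction (<-trans u<v v<w) (≤⇒≯ w≤u)
    ... | inj₁ u<v | inj₂ w≤v = (λ _ → less fu<fw) , λ _ → less fu<fw
      where fu<fw = Row-Col⇒< (r₁ u<v) (c₂ w≤v)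
    ... | inj₂ v≤u | inj₁ v<w = (λ _ → less fu<fw) , λ _ → less fu<fw
      where fu<fw = Col-Row⇒< (c₁ v≤u) (r₂ v<w)
    ... | inj₂ v≤u | inj₂ w≤v = (λ u<w → contradiction (≤-trans w≤v v≤u) (<⇒≱ u<w)) ,
                                λ _ → Col-trans (c₁ v≤u) (c₂ w≤v)

    before-suc : ∀ {u} → 1 ≤ u → u < n → Before u (suc u)
    before-suc {u} 1≤u u<n = Equivalence.to (compatible-≤ᵇ (f u) (f (suc u)))
      (subst (λ d → T (compatible d (f u) (f (suc u)))) (descent≡ t 1≤u u<n) (compat u 1≤u u<n))

    before : ∀ {u v} → 1 ≤ u → u < v → v ≤ n → Before u v
    before {u} {suc v} 1≤u u<v v<n with m<1+n⇒m<n∨m≡n u<v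
    ... | inj₂ refl = before-suc 1≤u v<n
    ... | inj₁ u<v′ = Before-trans {u} {v} {suc v} (before 1≤u u<v′ (<⇒≤ v<n))
      (before-suc (≤-trans 1≤u (<⇒≤ u<v′)) v<n)

    module _ {i j i′ j′ u v} (eu : hat t i j ≡ just u) (ev : hat t i′ j′ ≡ just v) (u<v : u < v) where
      Row⁺ : j < j′ → Row (f u) (f v)
      Row⁺ j<j′ = proj₁ (before (proj₁ (bounds {i} eu)) u<v (proj₂ (bounds {i′} ev)))
        (subst₂ _<_ (sym (colOf-hat t unique {i} eu)) (sym (colOf-hat t unique {i′} ev)) j<j′)

      Col⁺ : j′ ≤ j → Col (f u) (f v)
      Col⁺ j′≤j = proj₂ (before (proj₁ (bounds {i} eu)) u<v (proj₂ (bounds {i′} ev)))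
        (subst₂ _≤_ (sym (colOf-hat t unique {i′} ev)) (sym (colOf-hat t unique {i} eu)) j′≤j)

    -- Only an inner column with `u` below `v` goes against the reading direction. Let `w` be the
    -- left neighbour of `v`. If u < w, going left to `w` and right to `v` makes the letters
    -- strictly increase; if w < u, the triple condition gives v < u, a contradiction.
    same-column : ∀ {i i′ j u v} → hat t i j ≡ just u → hat t i′ j ≡ just v → u < v →
      (i , j , f u) ≺ (i′ , j , f v)
    same-column {i} {i′} {j} {u} {v} eu ev u<v with <-cmp i i′
    ... | tri≈ _ refl _ = contradiction (just-injective (trans (sym eu) ev)) (<⇒≢ u<v)
    same-column {i} {i′} {zero} eu ev u<v | _ with hat-bounds t {i} eu
    ... | _ , () , _
    same-column {i} {i′} {suc zero} eu ev u<v | tri< i<i′ _ _ =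
      Col⇒≺-leftmost i<i′ (Col⁺ {i} {_} {i′} eu ev u<v ≤-refl)
    same-column {i} {i′} {suc zero} {u} {v} eu ev u<v | tri> _ _ i′<i =
      contradiction (<ᵇ⇒< v u (Tableau-col< ne tab (λ {x} {y} {z} → <ᵇ-trans {x} {y} {z}) i′<i ev eu)) (<-asym u<v)
      where
      <ᵇ-trans : ∀ {x y z} → T (x <ᵇ y) → T (y <ᵇ z) → T (x <ᵇ z)
      <ᵇ-trans {x} {y} {z} p q = <⇒<ᵇ (<-trans (<ᵇ⇒< x y p) (<ᵇ⇒< y z q))
    same-column {i} {i′} {suc (suc j)} eu ev u<v | tri> _ _ i′<i =
      Col⇒≺-inner (s≤s z≤n) i′<i (Col⁺ {i} {_} {i′} eu ev u<v ≤-refl)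
    same-column {i} {i′} {suc (suc j)} {u} {v} eu ev u<v | tri< i<i′ _ _
      with hat-pred t {i′} (s≤s z≤n) ev
    ... | w , ew with <-cmp u w
    ...   | tri< u<w _ _ = inj₁ (Col-Row⇒< (Col⁺ {i} {_} {i′} eu ew u<w (n≤1+n _))
              (Row⁺ {i′} {suc j} {i′} ew ev (<ᵇ⇒< w v (Tableau.row tab {i′} {suc j} ew ev)) ≤-refl))
    ...   | tri≈ _ refl _ = contradiction
              (trans (sym (colOf-hat t unique {i} eu)) (colOf-hat t unique {i′} ew)) 1+n≢n
    ...   | tri> _ _ w<u with Tableau.triple tab i<i′ eu ew (<⇒<ᵇ w<u)
    ...     | x , ex , x<u with just-injective (trans (sym ex) ev)
    ...       | refl = contradiction (<ᵇ⇒< x u x<u) (<-asym u<v)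

    ≺⁺ : ∀ {i j i′ j′ u v} → hat t i j ≡ just u → hat t i′ j′ ≡ just v → u < v →
      (i , j , f u) ≺ (i′ , j′ , f v)
    ≺⁺ {i} {j} {i′} {j′} eu ev u<v with <-cmp j j′
    ... | tri< j<j′ _ _ = Row⇒≺ j<j′ (Row⁺ {i} {_} {i′} eu ev u<v j<j′)
    ... | tri> _ _ j′<j = Col⇒≺ j′<j (Col⁺ {i} {_} {i′} eu ev u<v (<⇒≤ j′<j))
    ... | tri≈ _ refl _ = same-column {i} {i′} {j} eu ev u<v

  filled-Tableau : Tableau rowRel colRel filled
  filled-Tableau = record { row = row′ ; col = col′ ; triple = triple′ }
    where
    row′ : ∀ {i j x y} → hat filled i j ≡ just x → hat filled i (suc j) ≡ just y → T (rowRel x y)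
    row′ {i} {j} ex ey with hat-map⁻ f t {i} {j} ex | hat-map⁻ f t {i} {suc j} ey
    ... | u , eu , refl | v , ev , refl = Equivalence.from (rowRel⇔Row (f u) (f v))
      (Row⁺ {i} {j} {i} eu ev (<ᵇ⇒< u v (Tableau.row tab {i} {j} eu ev)) ≤-refl)
    col′ : ∀ {i x y} → hat filled i 1 ≡ just x → hat filled (suc i) 1 ≡ just y → T (colRel x y)
    col′ {i} ex ey with hat-map⁻ f t {i} ex | hat-map⁻ f t {suc i} ey
    ... | u , eu , refl | v , ev , refl = Equivalence.from (colRel⇔Col (f u) (f v))
      (Col⁺ {i} {_} {suc i} eu ev (<ᵇ⇒< u v (Tableau.col tab {i} eu ev)) ≤-refl)
    triple′ : ∀ {i j m} → i < j → TripleAt rowRel colRel filled i j m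
    triple′ {i} {j} {m} i<j ex ey r with hat-map⁻ f t {i} ex | hat-map⁻ f t {j} ey
    ... | u , eu , refl | v , ev , refl with <-cmp v u
    -- If `u` came first, the move left from column `suc m` to `m` would give `Col (f u) (f v)`,
    -- against the assumed `Row (f v) (f u)`.
    ...   | tri> _ _ u<v = contradiction (Col⁺ {i} {_} {j} eu ev u<v (n≤1+n m))
              (Row-Col-asym (Equivalence.to (rowRel⇔Row (f v) (f u)) r))
    ...   | tri≈ _ refl _ = contradiction
              (trans (sym (colOf-hat t unique {i} eu)) (colOf-hat t unique {j} ev)) 1+n≢n
    ...   | tri< v<u _ _ with Tableau.triple tab i<j eu ev (<⇒<ᵇ v<u)
    ...     | w , ew , w<u = f w , hat-map⁺ f t {j} ew , Equivalence.from (colRel⇔Col (f w) (f u))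
                (Col⁺ {j} {_} {i} ew eu (<ᵇ⇒< w u w<u) ≤-refl)

  private
    -- By `≺⁺` and trichotomy, relabelling by `f` turns the order of the entries of `t` into `≺`, so
    -- the ranks agree; in a permutation of 1 to n each entry is its own rank.
    rank-filled : ∀ {c} → c ∈ cells t → rank (order filled) (mapValue f c) ≡ value c
    rank-filled {c@(i , j , v)} c∈ = begin
      rank (order filled) (mapValue f c)           ≡⟨ rank-↭ (mapValue f c) (order-↭ filled) ⟩
      rank (cells filled) (mapValue f c)           ≡⟨ cong (λ cs → rank cs (mapValue f c)) (cells-map f t) ⟩
      rank (map (mapValue f) (cells t)) (mapValue f c)
                                                   ≡⟨ cong suc (length-filter-map _ _ (cells t) order⇔) ⟩
      ℕRank.rank (map value (cells t)) v               ≡⟨ cong (λ vs → ℕRank.rank vs v) (value-cells t) ⟩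
      ℕRank.rank (concat t) v                          ≡⟨ ℕRank.rank-↭ v t↭ ⟩
      ℕRank.rank (interval n) v                        ≡⟨ ℕRank.rank-nth (interval-increasing n) (nth-interval 1≤v v≤n) ⟩
      v                                            ∎
      where
      open ≡-Reasoning
      module O = StrictTotalOrder (cellOrder k l)
      ec : hat t i j ≡ just v
      ec = ∈-cells⇒hat t c∈
      1≤v = proj₁ (bounds {i} ec)
      v≤n = proj₂ (bounds {i} ec)
      order⇔ : ∀ {d} → d ∈ cells t → (mapValue f d ≺ mapValue f c) ⇔ (value d < v)
      order⇔ {d@(i′ , j′ , u)} d∈ = mk⇔ to (≺⁺ {i′} {j′} {i} {j} (∈-cells⇒hat t d∈) ec)
        where
        to : mapValue f d ≺ mapValue f c → u < v
        to d≺c with <-cmp u v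
        ... | tri< u<v _ _ = u<v
        ... | tri> _ _ v<u = contradiction (≺⁺ {i} {j} {i′} {j′} ec (∈-cells⇒hat t d∈) v<u)
                               (O.asym {mapValue f d} {mapValue f c} d≺c)
        ... | tri≈ _ u≡v _ with Unique-map-injective value
                (subst Unique (sym (value-cells t)) unique) d∈ c∈ u≡v
        ...   | refl = contradiction d≺c (O.irrefl {mapValue f c} {mapValue f c} (refl , refl , refl))

  standardization-filled : standardization filled ≡ t
  standardization-filled = begin
    map (map (rank (order filled))) (annotate filled)
      ≡⟨ cong (map (map (rank (order filled)))) (annotateFrom-map f 0 t) ⟩
    map (map (rank (order filled))) (map (map (mapValue f)) (annotate t))
      ≡⟨ map-map-∘ (rank (order filled)) (mapValue f) (annotate t) ⟩
    map (map (rank (order filled) ∘ mapValue f)) (annotate t)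
      ≡⟨ map-map-cong (annotate t) rank-filled ⟩
    map (map value) (annotate t)
      ≡⟨ value-annotateFrom 0 t ⟩
    t ∎
    where open ≡-Reasoning

  sortedWord-filled : sortedWord filled ≡ map f (interval n)
  sortedWord-filled = sym (nth-ext _ _ lengths nths)
    where
    open ≡-Reasoning
    lengths : length (map f (interval n)) ≡ length (sortedWord filled)
    lengths = begin
      length (map f (interval n))            ≡⟨ length-map f (interval n) ⟩
      length (interval n)                    ≡⟨ Perm.↭-length (↭-sym t↭) ⟩
      length (concat t)                      ≡⟨ cong length (value-cells t) ⟨
      length (map value (cells t))           ≡⟨ length-map value (cells t) ⟩
      length (cells t)                       ≡⟨ length-map (mapValue f) (cells t) ⟨
      length (map (mapValue f) (cells t))    ≡⟨ cong length (cells-map f t) ⟨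
      length (cells filled)                  ≡⟨ Perm.↭-length (order-↭ filled) ⟨
      length (order filled)                  ≡⟨ length-map value (order filled) ⟨
      length (sortedWord filled)             ∎
    nths : ∀ {p x} → nth (map f (interval n)) p ≡ just x → nth (sortedWord filled) p ≡ just x
    nths {p} eq with map-just⁻ (nth (interval n) p) (trans (sym (nth-map f (interval n) p)) eq)
    ... | v , ev , refl
      -- Computing the rank of `v` in two ways identifies the position `p` with `v`; then some cell
      -- of `t` contains `v`.
      with trans (sym (ℕRank.rank-nth (interval-increasing n) {p} ev))
             (ℕRank.rank-nth (interval-increasing n) (nth-interval 1≤v v≤n))
         | ∈-map⁻ value (subst (v ∈_) (sym (value-cells t)) (Perm.∈-resp-↭ (↭-sym t↭) (nth-∈ _ {p} ev)))
      where
      1≤v = proj₁ (∈-interval⁻ (nth-∈ (interval n) {p} ev))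
      v≤n = proj₂ (∈-interval⁻ (nth-∈ (interval n) {p} ev))
    ... | refl | c , c∈ , refl = subst (λ q → nth (sortedWord filled) q ≡ just (f (value c)))
      (rank-filled c∈) (Standardize.nth-sortedWord (All.map⁺ (All.map (λ {r} → nonempty r) ne)) filled-Tableau
        (subst (mapValue f c ∈_) (sym (cells-map f t)) (∈-map⁺ (mapValue f) c∈)))
      where
      nonempty : ∀ r → 0 < length r → 0 < length (map f r)
      nonempty r = subst (0 <_) (sym (length-map f r))

-- Enumerations of words, fillings and pairs.

concatMap-map : {C : Set c} (f : A → B → C) (xs : List A) (ys : List B) →
  concatMap (λ x → map (f x) ys) xs ≡ cartesianProductWith f xs ys
concatMap-map f []       ys = refl
concatMap-map f (x ∷ xs) ys = cong (map (f x) ys ++_) (concatMap-map f xs ys)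

words-suc : (as : List A) (n : ℕ) → words as (suc n) ≡ cartesianProductWith _∷_ as (words as n)
words-suc as n = concatMap-map _∷_ as (words as n)

fillings-∷ : (as : List A) (m : ℕ) (α : List ℕ) →
  fillings as (m ∷ α) ≡ cartesianProductWith _∷_ (words as m) (fillings as α)
fillings-∷ as m α = concatMap-map _∷_ (words as m) (fillings as α)

∈-words⁺ : {as : List A} {w : List A} → All (_∈ as) w → w ∈ words as (length w)
∈-words⁺ [] = here refl
∈-words⁺ {as = as} {x ∷ w} (x∈ ∷ w∈) = subst (x ∷ w ∈_) (sym (words-suc as (length w)))
  (∈-cartesianProductWith⁺ _∷_ x∈ (∈-words⁺ w∈))

∈-words⁻ : {as : List A} (n : ℕ) {w : List A} → w ∈ words as n → length w ≡ n × All (_∈ as) w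
∈-words⁻ zero (here refl) = refl , []
∈-words⁻ {as = as} (suc n) {w} w∈ with ∈-cartesianProductWith⁻ _∷_ as (words as n)
  (subst (w ∈_) (words-suc as n) w∈)
... | x , v , x∈ , v∈ , refl with ∈-words⁻ n v∈
...   | eq , v∈as = cong suc eq , x∈ ∷ v∈as

words-unique : {as : List A} → Unique as → (n : ℕ) → Unique (words as n)
words-unique un zero = [] ∷ []
words-unique {as = as} un (suc n) = subst Unique (sym (words-suc as n))
  (Unique.cartesianProductWith⁺ _∷_ ∷-injective un (words-unique un n))

∈-fillings⁺ : {as : List A} {F : List (List A)} → All (All (_∈ as)) F → F ∈ fillings as (map length F)
∈-fillings⁺ [] = here refl
∈-fillings⁺ {as = as} {r ∷ F} (r∈ ∷ F∈) =
  subst (r ∷ F ∈_) (sym (fillings-∷ as (length r) (map length F)))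
    (∈-cartesianProductWith⁺ _∷_ (∈-words⁺ r∈) (∈-fillings⁺ F∈))

∈-fillings⁻ : {as : List A} (α : List ℕ) {F : List (List A)} → F ∈ fillings as α →
  map length F ≡ α × All (All (_∈ as)) F
∈-fillings⁻ [] (here refl) = refl , []
∈-fillings⁻ {as = as} (m ∷ α) {F} F∈ with ∈-cartesianProductWith⁻ _∷_ (words as m) (fillings as α)
  (subst (F ∈_) (fillings-∷ as m α) F∈)
... | r , G , r∈ , G∈ , refl with ∈-words⁻ m r∈ | ∈-fillings⁻ α G∈
...   | refl , r∈as | refl , G∈as = refl , r∈as ∷ G∈as

fillings-unique : {as : List A} → Unique as → (α : List ℕ) → Unique (fillings as α)
fillings-unique un [] = [] ∷ []
fillings-unique {as = as} un (m ∷ α) = subst Unique (sym (fillings-∷ as m α))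
  (Unique.cartesianProductWith⁺ _∷_ ∷-injective (words-unique un m) (fillings-unique un α))

∈-allLetters : (u : Letter k l) → u ∈ allLetters k l
∈-allLetters {k} {l} (inj₁ x) = ∈-++⁺ˡ (∈-map⁺ inj₁ (∈-allFin x))
∈-allLetters {k} {l} (inj₂ x) = ∈-++⁺ʳ (map inj₁ (allFin k)) (∈-map⁺ inj₂ (∈-allFin x))

allLetters-unique : (k l : ℕ) → Unique (allLetters k l)
allLetters-unique k l = Unique.++⁺
  (Unique.map⁺ (λ { refl → refl }) (Unique.allFin⁺ k))
  (Unique.map⁺ (λ { refl → refl }) (Unique.allFin⁺ l))
  disjoint
  where
  disjoint : Disjoint (map inj₁ (allFin k)) (map inj₂ (allFin l))
  disjoint (u∈ , u∈′) with ∈-map⁻ inj₁ u∈ | ∈-map⁻ inj₂ u∈′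
  ... | _ , _ , refl | _ , _ , ()

-- The first components keep the blocks of different `x` disjoint, even where the lists `ys x`
-- overlap.
concatMap-pairs-unique : {xs : List A} {ys : A → List B} → Unique xs → (∀ x → Unique (ys x)) →
  Unique (concatMap (λ x → map (x ,_) (ys x)) xs)
concatMap-pairs-unique [] un = []
concatMap-pairs-unique {xs = x ∷ xs} {ys} (x∉ ∷ unˣ) un = Unique.++⁺
  (Unique.map⁺ (λ { refl → refl }) (un x)) (concatMap-pairs-unique unˣ un) disjoint
  where
  disjoint : Disjoint (map (x ,_) (ys x)) (concatMap (λ x → map (x ,_) (ys x)) xs)
  disjoint (p∈ , p∈′) with ∈-map⁻ (x ,_) p∈ | ∈-concat⁻′ (map (λ x → map (x ,_) (ys x)) xs) p∈′
  ... | _ , _ , refl | _ , p∈r , r∈ with ∈-map⁻ (λ x → map (x ,_) (ys x)) r∈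
  ...   | x′ , x′∈ , refl with ∈-map⁻ (x′ ,_) p∈r
  ...     | _ , _ , refl = All.lookup x∉ x′∈ refl

∈-concatMap-pairs⁺ : {xs : List A} {ys : A → List B} {x : A} {y : B} → x ∈ xs → y ∈ ys x →
  (x , y) ∈ concatMap (λ x → map (x ,_) (ys x)) xs
∈-concatMap-pairs⁺ {ys = ys} {x} x∈ y∈ =
  ∈-concat⁺′ (∈-map⁺ (x ,_) y∈) (∈-map⁺ (λ x → map (x ,_) (ys x)) x∈)

∈-concatMap-pairs⁻ : (xs : List A) {ys : A → List B} {x : A} {y : B} →
  (x , y) ∈ concatMap (λ x → map (x ,_) (ys x)) xs → x ∈ xs × y ∈ ys x
∈-concatMap-pairs⁻ xs {ys} p∈ with ∈-concat⁻′ (map (λ x → map (x ,_) (ys x)) xs) p∈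
... | _ , p∈r , r∈ with ∈-map⁻ (λ x → map (x ,_) (ys x)) r∈
...   | x′ , x′∈ , refl with ∈-map⁻ (x′ ,_) p∈r
...     | _ , y∈ , refl = x′∈ , y∈

Unique-map⁺ : {f : A → B} {xs : List A} →
  (∀ {x y} → x ∈ xs → y ∈ xs → f x ≡ f y → x ≡ y) → Unique xs → Unique (map f xs)
Unique-map⁺ inj [] = []
Unique-map⁺ inj (x∉ ∷ un) =
  All.map⁺ (All.tabulate λ y∈ eq → All.lookup x∉ y∈ (inj (here refl) (there y∈) eq))
  ∷ Unique-map⁺ (λ x∈ y∈ → inj (there x∈) (there y∈)) un

-- Without repetitions all multiplicities are 0 or 1, so equality as sets is equality as bags.
Unique-set⇒↭ : {xs ys : List A} → Unique xs → Unique ys →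
  (∀ {x} → x ∈ xs → x ∈ ys) → (∀ {x} → x ∈ ys → x ∈ xs) → xs ↭ ys
Unique-set⇒↭ unˣ unʸ to from = ∼bag⇒↭ (unique∧set⇒bag unˣ unʸ (mk⇔ to from))

-- Counting entries and membership in `SHCT`.

count-here : ∀ v xs → count v (v ∷ xs) ≡ suc (count v xs)
count-here v xs rewrite ≡ᵇ-refl v = refl

count-there : ∀ {v x} xs → v ≢ x → count v (x ∷ xs) ≡ count v xs
count-there xs v≢x rewrite ≢⇒≡ᵇ-false v≢x = refl

count-∉ : ∀ {v} xs → v ∉ xs → count v xs ≡ 0
count-∉ []       v∉ = refl
count-∉ (x ∷ xs) v∉ = trans (count-there xs (v∉ ∘ here)) (count-∉ xs (v∉ ∘ there))

count-unique : ∀ {v xs} → Unique xs → v ∈ xs → count v xs ≡ 1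
count-unique {v} {_ ∷ xs} (x∉ ∷ un) (here refl) = trans (count-here v xs)
  (cong suc (count-∉ xs λ v∈ → All.lookup x∉ v∈ refl))
count-unique {xs = x ∷ xs} (x∉ ∷ un) (there v∈) =
  trans (count-there xs (All.lookup x∉ v∈ ∘ sym)) (count-unique un v∈)

count-∈ : ∀ {v n} xs → count v xs ≡ suc n → v ∈ xs
count-∈ {v} (x ∷ xs) eq with v ≟ x
... | yes refl = here refl
... | no v≢x   = there (count-∈ xs (trans (sym (count-there xs v≢x)) eq))

counts⇒Unique : ∀ xs → (∀ {v} → v ∈ xs → count v xs ≡ 1) → Unique xs
counts⇒Unique []       h = []
counts⇒Unique (x ∷ xs) h =
  All.tabulate (λ y∈ → λ { refl → x∉ y∈ })
  ∷ counts⇒Unique xs λ {v} v∈ →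
      trans (sym (count-there {v} {x} xs λ { refl → x∉ v∈ })) (h (there v∈))
  where
  count-zero : count x xs ≡ 0
  count-zero = suc-injective (trans (sym (count-here x xs)) (h (here refl)))
  count-positive : ∀ ys → x ∈ ys → count x ys ≢ 0
  count-positive (y ∷ ys) x∈ eq with x ≟ y
  ... | yes refl = contradiction (trans (sym (count-here x ys)) eq) λ ()
  ... | no x≢y with x∈
  ...   | here x≡y  = x≢y x≡y
  ...   | there x∈′ = count-positive ys x∈′ (trans (sym (count-there ys x≢y)) eq)
  x∉ : x ∉ xs
  x∉ x∈ = count-positive xs x∈ count-zero

length-concat : (F : List (List A)) → length (concat F) ≡ sum (map length F)
length-concat []      = refl
length-concat (r ∷ F) = trans (length-++ r) (cong (length r +_) (length-concat F))

shape-map : (f : A → B) (F : List (List A)) → map length (map (map f) F) ≡ map length F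
shape-map f F = trans (sym (map-∘ F)) (map-cong (length-map f) F)

shape⇒RowsNonempty : {F : List (List A)} {α : List ℕ} → map length F ≡ α → All (0 <_) α → RowsNonempty F
shape⇒RowsNonempty refl pos = All.map⁻ pos

SHCT⁻ : ∀ {α} → All (0 <_) α → ∀ {t} → t ∈ SHCT α →
  map length t ≡ α × concat t ↭ interval (sum α) × Tableau _<ᵇ_ _<ᵇ_ t
SHCT⁻ {α} pos {t} t∈ with ∈-filter⁻ _ {xs = fillings (interval (sum α)) α} t∈
... | t∈′ , ok with ∈-fillings⁻ α t∈′
                  | Equivalence.to (T-∧ {all (λ v → count v (concat t) ≡ᵇ 1) (fromTo 1 (sum α))}) ok
...   | shape , entries | counts , ok′ =
  shape ,
  Unique-set⇒↭ (counts⇒Unique (concat t) (count-one ∘ in-interval)) (interval-unique (sum α))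
    in-interval (λ v∈ → count-∈ (concat t) (count-one v∈)) ,
  isTableau⁻ _<ᵇ_ _<ᵇ_ (shctTriple t) t (shape⇒RowsNonempty shape pos)
    (λ i j n → Equivalence.to (shctTriple⇔ t i j n)) ok′
  where
  in-interval : ∀ {v} → v ∈ concat t → v ∈ interval (sum α)
  in-interval = All.lookup (All.concat⁺ entries)
  count-one : ∀ {v} → v ∈ interval (sum α) → count v (concat t) ≡ 1
  -- `fromTo 1 n` reduces to `interval n`, so the membership proof is used unchanged.
  count-one {v} v∈ = ≡ᵇ⇒≡ (count v (concat t)) 1
    (All.lookup (All.all⁺ (λ v → count v (concat t) ≡ᵇ 1) (fromTo 1 (sum α)) counts) v∈)

SHCT⁺ : ∀ {α} → All (0 <_) α → ∀ {t} → map length t ≡ α → concat t ↭ interval (sum α) →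
  Tableau _<ᵇ_ _<ᵇ_ t → t ∈ SHCT α
SHCT⁺ {α} pos {t} refl t↭ tab = ∈-filter⁺ _ (∈-fillings⁺ entries)
  (Equivalence.from (T-∧ {all (λ v → count v (concat t) ≡ᵇ 1) (fromTo 1 (sum α))})
    (All.all⁻ (λ v → count v (concat t) ≡ᵇ 1) (All.tabulate count-one) ,
     isTableau⁺ _<ᵇ_ _<ᵇ_ (shctTriple t) t (shape⇒RowsNonempty refl pos)
       (λ i j n → Equivalence.from (shctTriple⇔ t i j n)) tab))
  where
  entries : All (All (_∈ interval (sum α))) t
  entries = All.concat⁻ (All.tabulate (Perm.∈-resp-↭ t↭))
  count-one : ∀ {v} → v ∈ interval (sum α) → T (count v (concat t) ≡ᵇ 1)
  count-one {v} v∈ = ≡⇒≡ᵇ (count v (concat t)) 1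
    (count-unique (Unique-resp-↭ (↭-sym t↭) (interval-unique (sum α))) (Perm.∈-resp-↭ (↭-sym t↭) v∈))

SHCT-unique : ∀ α → Unique (SHCT α)
SHCT-unique α = Unique.filter⁺ _ (fillings-unique (interval-unique (sum α)) α)

mapMaybe-just : {C : Set c} (g : B → Maybe C) (h : A → B) (f : A → C) (xs : List A) →
  (∀ {x} → x ∈ xs → g (h x) ≡ just (f x)) → mapMaybe g (map h xs) ≡ map f xs
mapMaybe-just g h f []       eq = refl
mapMaybe-just g h f (x ∷ xs) eq rewrite eq (here refl) =
  cong (f x ∷_) (mapMaybe-just g h f xs (eq ∘ there))

sum≡0⇒[] : ∀ {α} → All (0 <_) α → sum α ≡ 0 → α ≡ []
sum≡0⇒[] []            _ = refl
sum≡0⇒[] (s≤s _ ∷ pos) ()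

map≡[]⇒[] : {f : A → B} {xs : List A} → map f xs ≡ [] → xs ≡ []
map≡[]⇒[] {xs = []} _ = refl

[]-Tableau : {r s : A → A → Bool} → Tableau r s []
[]-Tableau = record { row = λ () ; col = λ () ; triple = λ _ () }

word-as-function : (u : A) (w : List A) →
  map (λ v → fromMaybe u (nth w v)) (interval (length w)) ≡ w
word-as-function u w = sym (nth-ext w (map f (interval (length w)))
  (sym (trans (length-map f (interval (length w))) (length-interval (length w)))) λ {p} eq →
    trans (nth-map f (interval (length w)) p)
      (trans (cong (Maybe.map f) (nth-interval (proj₁ (nth-bounds w eq)) (proj₂ (nth-bounds w eq))))
        (cong (just ∘ fromMaybe u) eq)))
  where f = λ v → fromMaybe u (nth w v)

-- The bijection

module Bijection (k l : ℕ) (α : List ℕ) (pos : All (0 <_) α) where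
  open CellOrder {k} {l}

  HCTs : List (List (List (Letter k l)))
  HCTs = filterᵇ isHCT (fillings (allLetters k l) α)

  isCompatible : List (List ℕ) → List (Letter k l) → Bool
  isCompatible t = pairsIdxOK (λ i → compatible (descent (sum α) t i)) 1

  compatibleWords : List (List ℕ) → List (List (Letter k l))
  compatibleWords t = filterᵇ (isCompatible t) (words (allLetters k l) (sum α))

  -- Keeping the tableau beside the word counts a word once for each tableau it is compatible with.
  pairs : List (List (List ℕ) × List (Letter k l))
  pairs = concatMap (λ t → map (t ,_) (compatibleWords t)) (SHCT α)

  standardize : List (List (Letter k l)) → List (List ℕ) × List (Letter k l)
  standardize F = standardization F , sortedWord F

  HCTs⁻ : ∀ {F} → F ∈ HCTs → map length F ≡ α × Tableau rowRel colRel F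
  HCTs⁻ {F} F∈ with ∈-filter⁻ _ {xs = fillings (allLetters k l) α} F∈
  ... | F∈′ , ok with ∈-fillings⁻ α F∈′
  ...   | shape , _ = shape , isHCT⇒Tableau (shape⇒RowsNonempty shape pos) ok

  HCTs⁺ : ∀ {F} → map length F ≡ α → Tableau rowRel colRel F → F ∈ HCTs
  HCTs⁺ {F} shape tab = ∈-filter⁺ _
    (subst (λ β → F ∈ fillings (allLetters k l) β) shape
      (∈-fillings⁺ (All.universal (All.universal ∈-allLetters) F)))
    (Tableau⇒isHCT (shape⇒RowsNonempty shape pos) tab)

  sortedWord-↭ : ∀ F → sortedWord F ↭ concat F
  sortedWord-↭ F = subst (sortedWord F ↭_) (value-cells F) (Perm.map⁺ value (order-↭ F))

  length-order : ∀ {F} → map length F ≡ α → length (order F) ≡ sum α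
  length-order {F} shape = begin
    length (order F)      ≡⟨ length-map value (order F) ⟨
    length (sortedWord F) ≡⟨ Perm.↭-length (sortedWord-↭ F) ⟩
    length (concat F)     ≡⟨ length-concat F ⟩
    sum (map length F)    ≡⟨ cong sum shape ⟩
    sum α                 ∎
    where open ≡-Reasoning

  standardize-∈ : ∀ {F} → F ∈ HCTs → standardize F ∈ pairs
  standardize-∈ {F} F∈ with HCTs⁻ F∈
  ... | shape , tab = ∈-concatMap-pairs⁺
    (SHCT⁺ pos shape′ (subst (λ n → _ ↭ interval n) n≡ S.standardization-↭) S.standardization-Tableau)
    (∈-filter⁺ _
      (subst (λ n → sortedWord F ∈ words (allLetters k l) n) (trans (length-map value (order F)) n≡)
        (∈-words⁺ (All.universal ∈-allLetters (sortedWord F))))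
      (subst (λ n → T (pairsIdxOK (λ i → compatible (descent n (standardization F) i)) 1 (sortedWord F)))
        n≡ S.sortedWord-compatible))
    where
    module S = Standardize (shape⇒RowsNonempty shape pos) tab
    n≡ = length-order shape
    shape′ : map length (standardization F) ≡ α
    shape′ = begin
      map length (standardization F)           ≡⟨ shape-map _ (annotate F) ⟩
      map length (annotate F)                  ≡⟨ shape-map value (annotate F) ⟨
      map length (map (map value) (annotate F)) ≡⟨ cong (map length) (value-annotateFrom 0 F) ⟩
      map length F                             ≡⟨ shape ⟩
      α                                        ∎
      where open ≡-Reasoning

  -- A left inverse of `standardize` on `HCTs`, giving injectivity. `mapMaybe` makes the lookup
  -- total even when the alphabets are empty and offer no default letter.
  destandardize : List (List ℕ) × List (Letter k l) → List (List (Letter k l))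
  destandardize (t , w) = map (mapMaybe (nth w)) t

  destandardize-standardize : ∀ {F} → F ∈ HCTs → destandardize (standardize F) ≡ F
  destandardize-standardize {F} F∈ with HCTs⁻ F∈
  ... | shape , tab = begin
    map (mapMaybe (nth (sortedWord F))) (map (map (rank (order F))) (annotate F))
      ≡⟨ map-∘ (annotate F) ⟨
    map (mapMaybe (nth (sortedWord F)) ∘ map (rank (order F))) (annotate F)
      ≡⟨ map-cong-local (All.tabulate λ {r} r∈ → mapMaybe-just _ _ value r λ c∈ →
           Standardize.nth-sortedWord (shape⇒RowsNonempty shape pos) tab (∈-concat⁺′ c∈ r∈)) ⟩
    map (map value) (annotate F)
      ≡⟨ value-annotateFrom 0 F ⟩
    F ∎
    where open ≡-Reasoning

  ∈-standardize : ∀ {p} → p ∈ pairs → p ∈ map standardize HCTs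
  ∈-standardize {t , w} p∈ with ∈-concatMap-pairs⁻ (SHCT α) {compatibleWords} p∈
  ... | t∈ , w∈ with SHCT⁻ pos t∈ | ∈-filter⁻ _ {xs = words (allLetters k l) (sum α)} w∈
  ...   | shape , t↭ , tab | w∈′ , ok with ∈-words⁻ (sum α) w∈′
  ...     | len , _ = preimage w len ok
    where
    preimage : ∀ w → length w ≡ sum α → T (isCompatible t w) → (t , w) ∈ map standardize HCTs
    -- The empty word offers no default letter for `f`; here positivity of the parts forces `α` and
    -- `t` to be empty.
    preimage [] len ok = subst (_∈ map standardize HCTs)
      (cong₂ _,_ (sym t≡[]) (Perm.↭-empty-inv (sortedWord-↭ [])))
      (∈-map⁺ standardize (HCTs⁺ (sym α≡[]) []-Tableau))
      where
      α≡[] : α ≡ []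
      α≡[] = sum≡0⇒[] pos (sym len)
      t≡[] : t ≡ []
      t≡[] = map≡[]⇒[] (trans shape α≡[])
    preimage w@(u ∷ _) len ok = subst (_∈ map standardize HCTs)
      (cong₂ _,_ D.standardization-filled (trans D.sortedWord-filled w≡))
      (∈-map⁺ standardize (HCTs⁺ (trans (shape-map f t) shape) D.filled-Tableau))
      where
      f : ℕ → Letter k l
      -- The first letter of `w` is the default; lookups at 1 to `sum α` never reach it.
      f v = fromMaybe u (nth w v)
      w≡ : map f (interval (sum α)) ≡ w
      w≡ = subst (λ n → map f (interval n) ≡ w) len (word-as-function u w)
      nth-f : ∀ {i} → 1 ≤ i → i ≤ sum α → nth w i ≡ just (f i)
      nth-f {i} 1≤i i≤n = trans (cong (λ v → nth v i) (sym w≡))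
        (trans (nth-map f (interval (sum α)) i) (cong (Maybe.map f) (nth-interval 1≤i i≤n)))
      compat : ∀ i → 1 ≤ i → i < sum α → T (compatible (descent (sum α) t i) (f i) (f (suc i)))
      compat (suc i) 1≤i i<n = subst (λ q → T (compatible (descent (sum α) t q) (f (suc i)) (f (suc (suc i)))))
        (+-comm i 1) (pairsIdxOK⁻ 1 w ok {i} (nth-f 1≤i (<⇒≤ i<n)) (nth-f (s≤s z≤n) i<n))
      module D = Destandardize (shape⇒RowsNonempty shape pos) t↭ tab f compat

  -- Both lists are free of repetitions, the left one by injectivity, and `standardize-∈` and
  -- `∈-standardize` give them the same members.
  standardize-↭ : map standardize HCTs ↭ pairs
  standardize-↭ = Unique-set⇒↭
    (Unique-map⁺ (λ F∈ G∈ eq → trans (sym (destandardize-standardize F∈))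
        (trans (cong destandardize eq) (destandardize-standardize G∈)))
      (Unique.filter⁺ _ (fillings-unique (allLetters-unique k l) α)))
    (concatMap-pairs-unique (SHCT-unique α) λ t →
      Unique.filter⁺ _ (words-unique (allLetters-unique k l) (sum α)))
    (λ p∈ → let F , F∈ , eq = ∈-map⁻ standardize p∈ in subst (_∈ pairs) (sym eq) (standardize-∈ F∈))
    ∈-standardize

-- Finite sums in a commutative monoid, and the comparison of the two expansions.

module _ {c ℓ} (M : CommutativeMonoid c ℓ) where
  open CommutativeMonoid M using (Carrier; _∙_; ε; _≈_; isEquivalence; isCommutativeMonoid)
  private module CM = CommutativeMonoid M

  -- For the additive and multiplicative monoids of a semiring this is `sumR` and `prodR` by
  -- definition.
  fold : List Carrier → Carrier
  fold = foldr _∙_ ε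

  fold-map-↭ : (f : A → Carrier) {xs ys : List A} → xs ↭ ys → fold (map f xs) ≈ fold (map f ys)
  fold-map-↭ f p = PermS.foldr-commMonoid CM.setoid isCommutativeMonoid
    (↭⇒↭ₛ′ isEquivalence (Perm.map⁺ f p))

  fold-map-cong : {f g : A → Carrier} (xs : List A) → (∀ x → f x ≈ g x) →
    fold (map f xs) ≈ fold (map g xs)
  fold-map-cong []       eq = CM.refl
  fold-map-cong (x ∷ xs) eq = CM.∙-cong (eq x) (fold-map-cong xs eq)

  fold-++ : (xs ys : List Carrier) → fold (xs ++ ys) ≈ fold xs ∙ fold ys
  fold-++ []       ys = CM.sym (CM.identityˡ _)
  fold-++ (x ∷ xs) ys = CM.trans (CM.∙-congˡ (fold-++ xs ys)) (CM.sym (CM.assoc _ _ _))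

  fold-pairs : (f : B → Carrier) (ys : A → List B) (xs : List A) →
    fold (map (f ∘ proj₂) (concatMap (λ x → map (x ,_) (ys x)) xs))
      ≈ fold (map (λ x → fold (map f (ys x))) xs)
  fold-pairs f ys []       = CM.refl
  fold-pairs f ys (x ∷ xs) = CM.trans
    (CM.reflexive (trans (cong fold (map-++ (f ∘ proj₂) (map (x ,_) (ys x)) _))
      (cong (λ zs → fold (zs ++ _)) (sym (map-∘ (ys x))))))
    (CM.trans (fold-++ (map f (ys x)) _) (CM.∙-congˡ (fold-pairs f ys xs)))

theorem4p2 : ∀ {c ℓ} (R : CommutativeSemiring c ℓ) (k l n : ℕ)
    (x : Fin k → CommutativeSemiring.Carrier R)
    (y : Fin l → CommutativeSemiring.Carrier R)
    (α : List ℕ) → All (0 <_) α → sum α ≡ n →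
    CommutativeSemiring._≈_ R (HQ R k l x y α)
    (sumR R (map (λ T → Qtilde R k l x y n (descent n T)) (SHCT α)))
theorem4p2 R k l n x y α pos refl = begin
  fold +M (map (λ F → weight (concat F)) HCTs)
    -- Multiplication commutes, so sorting the entries of `F` keeps its weight, which then depends
    -- only on the word of the pair.
    ≈⟨ fold-map-cong +M HCTs (λ F → fold-map-↭ *M (z R x y) (↭-sym (sortedWord-↭ F))) ⟩
  fold +M (map (λ F → weight (sortedWord F)) HCTs)
    ≡⟨ cong (fold +M) (map-∘ HCTs) ⟩
  fold +M (map (weight ∘ proj₂) (map standardize HCTs))
    ≈⟨ fold-map-↭ +M (weight ∘ proj₂) standardize-↭ ⟩
  fold +M (map (weight ∘ proj₂) pairs)
    ≈⟨ fold-pairs +M weight compatibleWords (SHCT α) ⟩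
  -- `compatible` unfolds to the condition inside `Qtilde`, so the inner sums are the required ones
  -- by definition.
  fold +M (map (λ t → fold +M (map weight (compatibleWords t))) (SHCT α)) ∎
  where
  open CommutativeSemiring R using (Carrier)
  open Relation.Binary.Reasoning.Setoid (CommutativeSemiring.setoid R)
  open CellOrder {k} {l} using (sortedWord)
  open Bijection k l α pos
  +M = CommutativeSemiring.+-commutativeMonoid R
  *M = CommutativeSemiring.*-commutativeMonoid R
  weight : List (Letter k l) → Carrier
  weight w = prodR R (map (z R x y) w)
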